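{- Let $V$ be a model of set theory, $\kappa$ an infinite ordinal, $X\in V$ an infinite set, $\mathscr{L}\in V$ a relational language. Let $\mu\in V$ be a probability $\kappa$-measure on $[\mathrm{Str}^\kappa_{\mathscr{L}}(X)]^V$, and suppose $G$ is a $\mu$-random generic filter over $V$. Let $G_b$ be the set of basic $\kappa$-Borel codes belonging to $G$. Then the following hold. (a) $V[G]\models\bigl|\bigcap_{g\in G}\mathrm{Int}(g)\bigr|=1$. (b) $V[G]\models\bigcap_{g\in G}\mathrm{Int}(g)=\bigcap_{g\in G_b}\mathrm{Int}(g)$. (c) If $V[G]\models\{\mathcal{M}_G\}=\bigcap_{g\in G_b}\mathrm{Int}(g)$ then $$G=\{\zeta\in[\mathcal{O}^+(\mu)]^V : V[G]\models\mathcal{M}_G\in\mathrm{Int}(\zeta)\}.$$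
   Context: A model of set theory is a transitive model of ZFC. Structures and measures: $\mathrm{Str}_{\mathscr{L}}(X)$ is the set of $\mathscr{L}$-structures with underlying set $X$. An $\mathscr{L}$-literal is an atomic formula or a (possibly iterated) negation of one. $\sigma_\kappa(\mathrm{Str}_{\mathscr{L}}(X))$ is the smallest family of subsets of $\mathrm{Str}_{\mathscr{L}}(X)$ closed under complements and under unions of size $\le\kappa$ and containing all sets $\{\mathcal{M}:\mathcal{M}\models\varphi(\bar a)\}$ for $\varphi$ a literal and $\bar a$ a tuple from $X$. $\mathrm{Str}^\kappa_{\mathscr{L}}(X)$ is $\mathrm{Str}_{\mathscr{L}}(X)$ with this family of measurable sets. A probability $\kappa$-measure on it is a probability measure $\mu$ with $\mu(\bigcup_{i\in\kappa}A_i)=\sum_{i\in\kappa}\mu(A_i)$ for pairwise disjoint measurable $A_i$. Codes: the set $\mathbb{B}^\kappa_{\mathscr{L}:X}$ of $\kappa$-Borel codes is the smallest set containing the basic codes $\langle 0,\varphi,\bar a\rangle$ ($\varphi$ a finite conjunction of $\mathscr{L}$-literals, $\bar a$ a tuple from $X$ of length the arity of $\varphi$) and closed under formal negation $\neg\gamma$ and formal $\bigvee\Gamma$, $\bigwedge\Gamma$ for $\Gamma=\{\gamma_i\}_{i\in\kappa}$. The interpretation $\mathrm{Int}(\gamma)\subseteq\mathrm{Str}_{\mathscr{L}}(X)$, computed in a given model, interprets basic codes as $\{\mathcal{M}:\mathcal{M}\models\varphi(\bar a)\}$ and $\neg,\bigvee,\bigwedge$ as complement, union, intersection. $\mu(\gamma)=\mu(\mathrm{Int}(\gamma))$.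 Forcing: $\gamma\preceq_\mu\zeta$ means $\mu(\gamma\wedge\neg\zeta)=0$, and $\mathcal{O}^+(\mu)=(\{\gamma\in\mathbb{B}^\kappa_{\mathscr{L}:X}:\mu(\gamma)>0\},\preceq_\mu)$, a pre-order (smaller is stronger), computed in $V$. A $\mu$-random generic filter over $V$ is a filter on $\mathcal{O}^+(\mu)$ generic over $V$. -}

module Defs where

open import Level using (0ℓ) renaming (suc to lsuc)
open import Data.Empty using (⊥)
open import Data.Bool using (Bool; if_then_else_)
open import Data.Maybe using (Maybe; maybe)
open import Data.Nat using (ℕ; zero; suc)
open import Data.Integer using (ℤ; +_; -[1+_])
open import Data.Rational using (ℚ; 0ℚ; 1ℚ; _+_; _<_)
open import Data.Fin using (Fin; toℕ)
open import Data.Vec as Vec using (Vec; []; _∷_; lookup; toList)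
open import Data.Vec.Relation.Unary.All using () renaming (All to VecAll)
open import Data.List as List using (List; []; _∷_)
open import Data.List.Relation.Unary.All using (All)
open import Data.List.Relation.Unary.Any using (Any)
open import Data.List.Relation.Unary.AllPairs using (AllPairs)
open import Data.Product using (Σ; ∃; ∃₂; ∃!; _×_; _,_; proj₁; proj₂; uncurry)
open import Data.Sum using (_⊎_)
open import Relation.Nullary using (¬_)
open import Relation.Binary.PropositionalEquality using (_≡_)
open import Function.Bundles using (_⇔_)

infix 4 _≈_ _∈_ _∉_ _⊆_ _<Sum_

------------------------------------------------------------------------
-- The ambient cumulative hierarchy.  Equality of sets is the extensional
-- equality _≈_, never _≡_.

data 𝕍 : Set₁ where
  sup : (A : Set) → (A → 𝕍) → 𝕍

_≈_ : 𝕍 → 𝕍 → Set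
sup A f ≈ sup B g = (∀ a → ∃ λ b → f a ≈ g b) × (∀ b → ∃ λ a → f a ≈ g b)

_∈_ _∉_ : 𝕍 → 𝕍 → Set
x ∈ sup B g = ∃ λ b → x ≈ g b
x ∉ y = ¬ (x ∈ y)

_⊆_ : 𝕍 → 𝕍 → Set₁
x ⊆ y = ∀ z → z ∈ x → z ∈ y

Empty : 𝕍 → Set₁
Empty x = ∀ z → z ∉ x

Disjoint : 𝕍 → 𝕍 → Set₁
Disjoint x y = ∀ z → z ∈ x → z ∉ y

∅ : 𝕍
∅ = sup ⊥ λ ()

｛_,_｝ : 𝕍 → 𝕍 → 𝕍
｛ x , y ｝ = sup Bool λ b → if b then x else y

⟨_,_⟩ : 𝕍 → 𝕍 → 𝕍
⟨ x , y ⟩ = ｛ ｛ x , x ｝ , ｛ x , y ｝ ｝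

_⁺ : 𝕍 → 𝕍
sup A f ⁺ = sup (Maybe A) (maybe f (sup A f))

# : ℕ → 𝕍
# zero    = ∅
# (suc n) = # n ⁺

ω : 𝕍
ω = sup ℕ #

IsOrdinal : 𝕍 → Set₁
IsOrdinal α = (∀ x → x ∈ α → x ⊆ α) × (∀ x → x ∈ α → ∀ y → y ∈ x → y ⊆ x)

Infinite : 𝕍 → Set₁
Infinite x = ¬ (Σ (List 𝕍) λ ys → ∀ z → z ∈ x → Any (z ≈_) ys)

-- f is a function (a set of ordered pairs) with domain d.
IsFunctionOn : 𝕍 → 𝕍 → Set₁
IsFunctionOn d f =
    (∀ p → p ∈ f → ∃₂ λ x y → x ∈ d × p ≈ ⟨ x , y ⟩)
  × (∀ x → x ∈ d → ∃! _≈_ λ y → ⟨ x , y ⟩ ∈ f)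

-- Finite sequences and tuples, coded as iterated ordered pairs.
sequence : List 𝕍 → 𝕍
sequence []       = ∅
sequence (x ∷ xs) = ⟨ x , sequence xs ⟩

tuple : ∀ {n} → Vec 𝕍 n → 𝕍
tuple v = sequence (toList v)

------------------------------------------------------------------------
-- Transitive models of ZFC

Class : Set₂
Class = 𝕍 → Set₁

-- First-order formulas of set theory with free variables in Fin n.
data Formula : ℕ → Set where
  _∈′_ _≈′_      : ∀ {n} → Fin n → Fin n → Formula n
  ¬′_            : ∀ {n} → Formula n → Formula n
  _∧′_ _∨′_ _⇒′_ : ∀ {n} → Formula n → Formula n → Formula n
  ∀′_ ∃′_        : ∀ {n} → Formula (suc n) → Formula n

-- Satisfaction in the structure (M , ∈).
infix 4 _⊨_[_]
_⊨_[_] : Class → ∀ {n} → Formula n → Vec 𝕍 n → Set₁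
M ⊨ i ∈′ j [ ρ ] = Level.Lift (lsuc 0ℓ) (lookup ρ i ∈ lookup ρ j)
M ⊨ i ≈′ j [ ρ ] = Level.Lift (lsuc 0ℓ) (lookup ρ i ≈ lookup ρ j)
M ⊨ ¬′ φ   [ ρ ] = ¬ (M ⊨ φ [ ρ ])
M ⊨ φ ∧′ ψ [ ρ ] = (M ⊨ φ [ ρ ]) × (M ⊨ ψ [ ρ ])
M ⊨ φ ∨′ ψ [ ρ ] = (M ⊨ φ [ ρ ]) ⊎ (M ⊨ ψ [ ρ ])
M ⊨ φ ⇒′ ψ [ ρ ] = (M ⊨ φ [ ρ ]) → (M ⊨ ψ [ ρ ])
M ⊨ ∀′ φ   [ ρ ] = ∀ x → M x → M ⊨ φ [ x ∷ ρ ]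
M ⊨ ∃′ φ   [ ρ ] = ∃ λ x → M x × (M ⊨ φ [ x ∷ ρ ])

-- The axioms of ZFC relativised to M; M is assumed transitive where this
-- is used, so quantifiers bounded by an element of M need no guard.
record ZFC (M : Class) : Set₁ where
  field
    extensionality : ∀ x y → M x → M y → x ⊆ y → y ⊆ x → x ≈ y
    foundation     : ∀ x → M x → ¬ Empty x → ∃ λ y → y ∈ x × Disjoint y x
    pairing        : ∀ x y → M x → M y →
                     ∃ λ p → M p × (∀ z → M z → z ∈ p ⇔ (z ≈ x ⊎ z ≈ y))
    union          : ∀ x → M x →
                     ∃ λ u → M u × (∀ z → M z → z ∈ u ⇔ (∃ λ y → y ∈ x × z ∈ y))
    powerset       : ∀ x → M x →
                     ∃ λ p → M p × (∀ z → M z → z ∈ p ⇔ z ⊆ x)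
    infinity       : ∃ λ w → M w × (∃ λ e → e ∈ w × Empty e)
                     × (∀ x → x ∈ w → ∃ λ s → s ∈ w × (∀ z → z ∈ s ⇔ (z ∈ x ⊎ z ≈ x)))
    separation     : ∀ {n} (φ : Formula (suc n)) (ps : Vec 𝕍 n) → VecAll M ps →
                     ∀ x → M x →
                     ∃ λ s → M s × (∀ z → M z → z ∈ s ⇔ (z ∈ x × (M ⊨ φ [ z ∷ ps ])))
    replacement    : ∀ {n} (φ : Formula (suc (suc n))) (ps : Vec 𝕍 n) → VecAll M ps →
                     ∀ x → M x →
                     (∀ a b c → a ∈ x → M b → M c →
                        M ⊨ φ [ a ∷ b ∷ ps ] → M ⊨ φ [ a ∷ c ∷ ps ] → b ≈ c) →
                     ∃ λ r → M r ×
                       (∀ b → M b → b ∈ r ⇔ (∃ λ a → a ∈ x × (M ⊨ φ [ a ∷ b ∷ ps ])))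
    choice         : ∀ x → M x → (∀ y → y ∈ x → ¬ Empty y) →
                     (∀ y z → y ∈ x → z ∈ x → ¬ (y ≈ z) → Disjoint y z) →
                     ∃ λ c → M c × (∀ y → y ∈ x → ∃! _≈_ λ z → z ∈ y × z ∈ c)

record IsModel (M : Class) : Set₁ where
  field
    respects   : ∀ {x y} → x ≈ y → M x → M y
    transitive : ∀ {x y} → x ∈ y → M y → M x
    zfc        : ZFC M

-- Smallest M C T : T is, in the sense of M, the smallest set satisfying C.
Smallest : Class → (𝕍 → Set₁) → 𝕍 → Set₁
Smallest M C T = M T × C T × (∀ T′ → M T′ → C T′ → T ⊆ T′)

------------------------------------------------------------------------
-- Real numbers in a transitive model: Dedekind lower cuts in ℚ, with
-- rationals coded by hereditarily finite sets.

codeℤ : ℤ → 𝕍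
codeℤ (+ n)    = ⟨ # 0 , # n ⟩
codeℤ -[1+ n ] = ⟨ # 1 , # n ⟩

codeℚ : ℚ → 𝕍
codeℚ q = ⟨ codeℤ (ℚ.numerator q) , # (ℚ.denominator-1 q) ⟩

record IsReal (r : 𝕍) : Set₁ where
  field
    rational  : ∀ x → x ∈ r → ∃ λ q → x ≈ codeℚ q
    inhabited : ∃ λ q → codeℚ q ∈ r
    bounded   : ∃ λ q → codeℚ q ∉ r
    downward  : ∀ p q → p < q → codeℚ q ∈ r → codeℚ p ∈ r
    open′     : ∀ p → codeℚ p ∈ r → ∃ λ q → p < q × codeℚ q ∈ r

-- For a real r, codeℚ q ∈ r says q < r.
Is : ℚ → 𝕍 → Set
Is q r = ∀ p → codeℚ p ∈ r ⇔ p < q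

NonNegative Positive : 𝕍 → Set
NonNegative r = ∀ q → q < 0ℚ → codeℚ q ∈ r
Positive r = codeℚ 0ℚ ∈ r

-- The lower cut of a finite sum of reals.
_<Sum_ : ℚ → List 𝕍 → Set
q <Sum []       = q < 0ℚ
q <Sum (r ∷ rs) = ∃₂ λ p p′ → q ≡ p + p′ × codeℚ p ∈ r × p′ <Sum rs

-- r is the sum of the family of non-negative reals with graph R (R i s:
-- the i-th term is s), i.e. the supremum of the sums over finitely many
-- distinct indices.
IsSum : (𝕍 → 𝕍 → Set₁) → 𝕍 → Set₁
IsSum R r = ∀ q → codeℚ q ∈ r ⇔
  (Σ (List (𝕍 × 𝕍)) λ ts →
     All (uncurry R) ts
   × AllPairs (λ t t′ → ¬ (proj₁ t ≈ proj₁ t′)) ts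
   × q <Sum List.map proj₂ ts)

------------------------------------------------------------------------
-- Structures, literals and codes

-- A relational language: a function taking relation symbols to arities.
IsRelationalLanguage : 𝕍 → Set₁
IsRelationalLanguage L =
    (∃ λ d → IsFunctionOn d L)
  × (∀ R k → ⟨ R , k ⟩ ∈ L → ∃ λ n → k ≈ # n)

module _ (L : 𝕍) where

  data Literal (n : ℕ) : Set₁ where
    rel : ∀ R k → ⟨ R , # k ⟩ ∈ L → Vec (Fin n) k → Literal n
    eq  : Fin n → Fin n → Literal n
    neg : Literal n → Literal n

  -- Finite conjunctions of literals in the variables Fin n; n is the arity.
  Conjunction : ℕ → Set₁
  Conjunction n = List (Literal n)

module _ {L : 𝕍} where

  codeFin : ∀ {n} → Fin n → 𝕍
  codeFin i = # (toℕ i)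

  codeLiteral : ∀ {n} → Literal L n → 𝕍
  codeLiteral (rel R k _ is) = ⟨ # 0 , ⟨ R , tuple (Vec.map codeFin is) ⟩ ⟩
  codeLiteral (eq i j)       = ⟨ # 1 , ⟨ codeFin i , codeFin j ⟩ ⟩
  codeLiteral (neg l)        = ⟨ # 2 , codeLiteral l ⟩

  codeConjunction : ∀ {n} → Conjunction L n → 𝕍
  codeConjunction φ = sequence (List.map codeLiteral φ)

  -- A structure with the given underlying set is represented by the set m
  -- of pairs ⟨ R , ā ⟩ such that R holds of the tuple ā.
  SatLiteral : ∀ {n} → 𝕍 → Literal L n → Vec 𝕍 n → Set
  SatLiteral m (rel R k _ is) a = ⟨ R , tuple (Vec.map (lookup a) is) ⟩ ∈ m
  SatLiteral m (eq i j)       a = lookup a i ≈ lookup a j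
  SatLiteral m (neg l)        a = ¬ SatLiteral m l a

  SatConjunction : ∀ {n} → 𝕍 → Conjunction L n → Vec 𝕍 n → Set₁
  SatConjunction m φ a = All (λ l → SatLiteral m l a) φ

  basicᶜ : ∀ {n} → Conjunction L n → Vec 𝕍 n → 𝕍
  basicᶜ φ a = ⟨ # 0 , ⟨ codeConjunction φ , tuple a ⟩ ⟩

¬ᶜ_ ⋁ᶜ_ ⋀ᶜ_ : 𝕍 → 𝕍
¬ᶜ γ = ⟨ # 1 , γ ⟩
⋁ᶜ Γ = ⟨ # 2 , Γ ⟩
⋀ᶜ Γ = ⟨ # 3 , Γ ⟩

_∧ᶜ_ : 𝕍 → 𝕍 → 𝕍
γ ∧ᶜ ζ = ⋀ᶜ ｛ γ , ζ ｝

_FromSet_ : ∀ {n} → Vec 𝕍 n → 𝕍 → Set₁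
a FromSet X = VecAll (_∈ X) a

module _ (κ X L : 𝕍) where

  IsStructure : 𝕍 → Set₁
  IsStructure m = ∀ p → p ∈ m → ∃₂ λ R k → Σ (Vec 𝕍 k) λ a →
    ⟨ R , # k ⟩ ∈ L × a FromSet X × p ≈ ⟨ R , tuple a ⟩

  IsBasicCode : 𝕍 → Set₁
  IsBasicCode c = ∃ λ n → Σ (Conjunction L n) λ φ → Σ (Vec 𝕍 n) λ a →
    a FromSet X × c ≈ basicᶜ φ a

  -- Γ = {γᵢ}_{i∈κ} for some family (γᵢ)_{i∈κ} in M.
  IsFamily : Class → 𝕍 → Set₁
  IsFamily M Γ = ∃ λ f → M f × IsFunctionOn κ f
                       × (∀ γ → γ ∈ Γ ⇔ (∃ λ i → ⟨ i , γ ⟩ ∈ f))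

  record CodeClosed (M : Class) (T : 𝕍) : Set₁ where
    field
      basic-closed : ∀ c → IsBasicCode c → c ∈ T
      ¬-closed     : ∀ γ → γ ∈ T → (¬ᶜ γ) ∈ T
      ⋁-closed     : ∀ Γ → M Γ → IsFamily M Γ → Γ ⊆ T → (⋁ᶜ Γ) ∈ T
      ⋀-closed     : ∀ Γ → M Γ → IsFamily M Γ → Γ ⊆ T → (⋀ᶜ Γ) ∈ T

  -- The sets which M takes to be Str_L(X), the set of κ-Borel codes, and
  -- the interpretation function Int on codes.  As M ⊨ ZFC, these exist in
  -- M and are unique up to _≈_: this record is their definition in M.
  record BorelCodes (M : Class) : Set₁ where
    field
      Str 𝔹 Int : 𝕍
      Str∈M   : M Str
      Str-def : ∀ m → m ∈ Str ⇔ (M m × IsStructure m)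
      𝔹-def   : Smallest M (CodeClosed M) 𝔹
      Int∈M   : M Int
      Int-fun : IsFunctionOn 𝔹 Int
      Int-basic : ∀ {n} (φ : Conjunction L n) (a : Vec 𝕍 n) S → a FromSet X →
                  ⟨ basicᶜ φ a , S ⟩ ∈ Int →
                  ∀ m → m ∈ S ⇔ (m ∈ Str × SatConjunction m φ a)
      Int-neg   : ∀ γ S T → ⟨ γ , S ⟩ ∈ Int → ⟨ ¬ᶜ γ , T ⟩ ∈ Int →
                  ∀ m → m ∈ T ⇔ (m ∈ Str × m ∉ S)
      Int-⋁     : ∀ Γ T → ⟨ ⋁ᶜ Γ , T ⟩ ∈ Int →
                  ∀ m → m ∈ T ⇔ (∃₂ λ γ S → γ ∈ Γ × ⟨ γ , S ⟩ ∈ Int × m ∈ S)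
      Int-⋀     : ∀ Γ T → ⟨ ⋀ᶜ Γ , T ⟩ ∈ Int →
                  ∀ m → m ∈ T ⇔ (m ∈ Str × (∀ γ S → γ ∈ Γ → ⟨ γ , S ⟩ ∈ Int → m ∈ S))

    infix 4 _∈Int_
    _∈Int_ : 𝕍 → 𝕍 → Set₁
    m ∈Int γ = ∃ λ S → ⟨ γ , S ⟩ ∈ Int × m ∈ S

    -- m ∈ ⋂ {Int(g) : g ∈ C}, computed in M.
    InAllInt : (𝕍 → Set₁) → 𝕍 → Set₁
    InAllInt C m = M m × (∀ g → C g → m ∈Int g)

  module _ {V : Class} (B : BorelCodes V) where
    open BorelCodes B

    -- In V, there is an injection of x into κ.
    SizeAtMostκ : 𝕍 → Set₁
    SizeAtMostκ x = ∃ λ f → V f × IsFunctionOn x f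
      × (∀ y i → ⟨ y , i ⟩ ∈ f → i ∈ κ)
      × (∀ y z i → ⟨ y , i ⟩ ∈ f → ⟨ z , i ⟩ ∈ f → y ≈ z)

    record MeasurableClosed (T : 𝕍) : Set₁ where
      field
        literal    : ∀ {n} (l : Literal L n) (a : Vec 𝕍 n) → a FromSet X →
                     ∀ S → V S → (∀ m → m ∈ S ⇔ (m ∈ Str × SatLiteral m l a)) → S ∈ T
        complement : ∀ S → S ∈ T →
                     ∀ S′ → V S′ → (∀ m → m ∈ S′ ⇔ (m ∈ Str × m ∉ S)) → S′ ∈ T
        union      : ∀ F → V F → F ⊆ T → SizeAtMostκ F →
                     ∀ U → V U → (∀ m → m ∈ U ⇔ (∃ λ S → S ∈ F × m ∈ S)) → U ∈ T

    -- μ(⋃_{i∈α} Aᵢ) = Σ_{i∈α} μ(Aᵢ) for every pairwise disjoint family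
    -- (Aᵢ)_{i∈α} in V of members of σ.
    Additive : (σ μ α : 𝕍) → Set₁
    Additive σ μ α = ∀ A → V A → IsFunctionOn α A →
      (∀ i S → ⟨ i , S ⟩ ∈ A → S ∈ σ) →
      (∀ i j S T → ⟨ i , S ⟩ ∈ A → ⟨ j , T ⟩ ∈ A → ¬ (i ≈ j) → Disjoint S T) →
      ∀ U r → (∀ m → m ∈ U ⇔ (∃₂ λ i S → ⟨ i , S ⟩ ∈ A × m ∈ S)) → ⟨ U , r ⟩ ∈ μ →
      IsSum (λ i s → ∃ λ S → ⟨ i , S ⟩ ∈ A × ⟨ S , s ⟩ ∈ μ) r

    record IsProbabilityκMeasure (μ : 𝕍) : Set₁ where
      field
        σ           : 𝕍
        σ-def       : Smallest V MeasurableClosed σ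
        function    : IsFunctionOn σ μ
        real        : ∀ S r → ⟨ S , r ⟩ ∈ μ → IsReal r × NonNegative r
        null        : ∀ S r → Empty S → ⟨ S , r ⟩ ∈ μ → Is 0ℚ r
        total       : ∀ r → ⟨ Str , r ⟩ ∈ μ → Is 1ℚ r
        σ-additive  : Additive σ μ ω
        κ-additive  : Additive σ μ κ

    module _ (μ : 𝕍) where

      -- r = μ(γ) = μ(Int(γ)).
      MeasureOf : 𝕍 → 𝕍 → Set₁
      MeasureOf γ r = ∃ λ S → ⟨ γ , S ⟩ ∈ Int × ⟨ S , r ⟩ ∈ μ

      InO⁺ : 𝕍 → Set₁
      InO⁺ γ = γ ∈ 𝔹 × (∃ λ r → MeasureOf γ r × Positive r)

      infix 4 _≼_
      _≼_ : 𝕍 → 𝕍 → Set₁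
      γ ≼ ζ = ∃ λ r → MeasureOf (γ ∧ᶜ (¬ᶜ ζ)) r × Is 0ℚ r

      IsDense : 𝕍 → Set₁
      IsDense D = (∀ δ → δ ∈ D → InO⁺ δ)
                × (∀ γ → InO⁺ γ → ∃ λ δ → δ ∈ D × δ ≼ γ)

      record IsRandomGenericFilter (G : 𝕍) : Set₁ where
        field
          subset   : ∀ γ → γ ∈ G → InO⁺ γ
          nonempty : ∃ λ γ → γ ∈ G
          upward   : ∀ γ ζ → γ ∈ G → InO⁺ ζ → γ ≼ ζ → ζ ∈ G
          directed : ∀ γ ζ → γ ∈ G → ζ ∈ G → ∃ λ ξ → ξ ∈ G × ξ ≼ γ × ξ ≼ ζ
          generic  : ∀ D → V D → IsDense D → ∃ λ δ → δ ∈ D × δ ∈ G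

-- W = V[G]: the least transitive model of ZFC including V and containing G.
record IsGenericExtension (V : Class) (G : 𝕍) (W : Class) : Set₂ where
  field
    model    : IsModel W
    includes : ∀ x → V x → W x
    contains : W G
    least    : ∀ N → IsModel N → (∀ x → V x → N x) → N G → ∀ x → W x → N x

{-# OPTIONS --safe #-}
module Submission where

-- The sets Int γ with γ ∈ G form a V-generic ultrafilter on measurable sets of V:
-- a κ-indexed union of null sets is null, so the conditions lying below some Int γᵢ, or
-- disjoint from Int δ, are dense whenever the Int γᵢ cover Int δ; hence G contains some
-- γᵢ as soon as it contains δ.  In V[G] let 𝓜 hold of those atoms that are true in
-- all structures of some Int g with g ∈ G.  By induction on codes ζ ∈ V, 𝓜 ∈ Int ζ in
-- V[G] exactly if ζ ∈ G, and the basic codes in G already decide every atom.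

open import Defs
open import Level using (Level; 0ℓ; lift; lower; _⊔_) renaming (suc to lsuc)
open import Axiom.ExcludedMiddle using (ExcludedMiddle)
open import Data.Bool using (true; false; if_then_else_)
open import Data.Empty using (⊥-elim)
open import Data.Fin as Fin using (Fin; zero; suc)
open import Data.Fin.Patterns
open import Data.List as List using (List; []; _∷_)
open import Data.List.Relation.Unary.All as ListAll using ([]; _∷_) renaming (All to ListAll)
open import Data.List.Relation.Unary.All.Properties using (map⁺)
open import Data.List.Relation.Unary.AllPairs using ([]; _∷_)
open import Data.List.Relation.Unary.Any using (here)
open import Data.Nat using (ℕ; zero; suc)
open import Data.Product using (∃; ∃₂; ∃!; _×_; _,_; proj₁; proj₂; uncurry)
open import Data.Product.Function.NonDependent.Propositional using (_×-⇔_)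
open import Data.Rational using (ℚ; 0ℚ; 1ℚ; _<_; -_)
open import Data.Rational.Properties using (_<?_; <-cmp; <-irrefl; +-mono-<; +-inverseʳ; neg-antimono-<)
open import Data.Sum as Sum using (_⊎_; inj₁; inj₂; [_,_])
open import Data.Sum.Function.Propositional using (_⊎-⇔_)
open import Data.Vec as Vec using (Vec; []; _∷_; lookup)
open import Data.Vec.Properties using (map-lookup-allFin)
open import Data.Vec.Relation.Unary.All using ([]; _∷_) renaming (All to VecAll)
open import Data.Vec.Relation.Unary.All.Properties using (lookup⁺)
open import Function using (_∘_; id)
open import Function.Bundles using (_⇔_; mk⇔; module Equivalence)
open import Function.Construct.Composition using (_⇔-∘_)
open import Function.Construct.Symmetry using (⇔-sym)
open import Function.Related.TypeIsomorphisms using (→-cong-⇔; ¬-cong-⇔)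
open import Induction.WellFounded using (Acc; acc; WellFounded; module All)
open import Relation.Binary.Construct.Closure.Transitive as TransClosure using (TransClosure)
open import Relation.Binary.Definitions using (tri<; tri≈; tri>)
open import Relation.Binary.PropositionalEquality using (refl; sym; subst)
open import Relation.Nullary using (¬_; Dec; yes; no; contradiction)
open import Relation.Nullary.Decidable using (map′; toWitness)

open Equivalence using (to; from)

-- Two features of the setting shape the proof. Codes join and meet families indexed by exactly `κ`,
-- an arbitrary infinite ordinal, and additivity speaks only of disjoint families that belong to V.
-- Monotonicity and κ-completeness of the null ideal therefore come from one device: a κ-indexed
-- family is made disjoint inside V by keeping first occurrences along the ordinal, and a pair
-- counts as a κ-indexed family with one value at index zero and the other elsewhere. As the forcing
-- sees only whether a measure is positive, just the sign of a sum has to be controlled. Secondly,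
-- `𝔹` is smallest only among the sets of V, while membership in `G` and truth in V[G] need not be
-- definable in V. Minimality thus serves only to read off the shape of a single code; the induction
-- itself runs along `∈`, outside the models. Nor can the interpretations in V and in V[G] be
-- matched as sets, since `𝓜` need not lie in V: the truth lemma links them through `G` alone.

private
  variable
    a b c d f i j m p r s u v x y z C N R S T U Γ γ δ ζ ξ : 𝕍
    q : ℚ
    ℓ : Level
    n k : ℕ

-- Sets, ordinals and definability

≈-refl : x ≈ x
≈-refl {sup A f} = (λ a → a , ≈-refl) , (λ a → a , ≈-refl)

≈-sym : x ≈ y → y ≈ x
≈-sym {sup A f} {sup B g} (p , q) =
  (λ b → let a , e = q b in a , ≈-sym e) , (λ a → let b , e = p a in b , ≈-sym e)

≈-trans : x ≈ y → y ≈ z → x ≈ z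
≈-trans {sup A f} {sup B g} {sup C h} (p , q) (p′ , q′) =
  (λ a → let b , e = p a ; c , e′ = p′ b in c , ≈-trans e e′) ,
  (λ c → let b , e′ = q′ c ; a , e = q b in a , ≈-trans e e′)

∈-respˡ : x ≈ y → x ∈ z → y ∈ z
∈-respˡ {z = sup C h} e (c , e′) = c , ≈-trans (≈-sym e) e′

∈-respʳ : x ≈ y → z ∈ x → z ∈ y
∈-respʳ {sup A f} {sup B g} (p , _) (a , e) = let b , e′ = p a in b , ≈-trans e e′

⊆-antisym : x ⊆ y → y ⊆ x → x ≈ y
⊆-antisym {sup A f} {sup B g} p q =
  (λ a → p (f a) (a , ≈-refl)) ,
  (λ b → let a , e = q (g b) (b , ≈-refl) in a , ≈-sym e)

∈-wellFounded : WellFounded _∈_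
∈-wellFounded _ = accessible ≈-refl
  where
  -- A member of `sup B g` is only `≈` to some branch `g b`, so the recursion is on the
  -- representative `y` while the claim covers every `x ≈ y`.
  accessible : x ≈ y → Acc _∈_ x
  accessible {y = sup B g} e = acc λ z∈x →
    let b , e′ = ∈-respʳ e z∈x in accessible e′

-- The double negation makes `∈`-induction suffice without excluded middle; classical callers remove
-- it.
¬¬minimal : (P : 𝕍 → Set ℓ) → ∃ P → ¬ ¬ (∃ λ i → P i × (∀ j → j ∈ i → ¬ P j))
¬¬minimal P (i , Pi) none = All.wfRec ∈-wellFounded _ (λ i → ¬ P i)
  (λ i rec Pi → none (i , Pi , λ _ j∈i → rec j∈i)) i Pi

∈-irrefl : x ∉ x
∈-irrefl {x} = All.wfRec ∈-wellFounded _ (λ x → x ∉ x) (λ x rec x∈x → rec x∈x x∈x) x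

∈-｛｝ : z ∈ ｛ x , y ｝ ⇔ (z ≈ x ⊎ z ≈ y)
∈-｛｝ = mk⇔ (λ { (true , e) → inj₁ e ; (false , e) → inj₂ e })
             [ (true ,_) , (false ,_) ]

x∈｛x,y｝ : x ∈ ｛ x , y ｝
x∈｛x,y｝ = true , ≈-refl

y∈｛x,y｝ : y ∈ ｛ x , y ｝
y∈｛x,y｝ = false , ≈-refl

｛｝-cong : x ≈ y → u ≈ v → ｛ x , u ｝ ≈ ｛ y , v ｝
｛｝-cong e e′ = (λ { true → true , e ; false → false , e′ })
             , (λ { true → true , e ; false → false , e′ })

⟨⟩-cong : x ≈ y → u ≈ v → ⟨ x , u ⟩ ≈ ⟨ y , v ⟩
⟨⟩-cong e e′ = ｛｝-cong (｛｝-cong e e) (｛｝-cong e e′)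

singleton-injective : ｛ x , x ｝ ≈ ｛ a , b ｝ → x ≈ a × x ≈ b
singleton-injective (_ , q) =
    (let _ , e = q true in either e) , (let _ , e = q false in either e)
  where
  either : ∀ {i} → (if i then x else x) ≈ y → x ≈ y
  either {i = true}  e = e
  either {i = false} e = e

⟨⟩-injective : ⟨ x , y ⟩ ≈ ⟨ a , b ⟩ → x ≈ a × y ≈ b
⟨⟩-injective {x} {y} {a} {b} (p , q) = x≈a , y≈b
  where
  x≈a : x ≈ a
  x≈a with p true
  ... | true  , e = proj₁ (singleton-injective e)
  ... | false , e = proj₁ (singleton-injective e)

  y≈a⊎y≈b : y ≈ a ⊎ y ≈ b
  y≈a⊎y≈b with p false
  ... | true  , (p′ , _) = [ inj₁ , inj₁ ] (to ∈-｛｝ (p′ false))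
  ... | false , (p′ , _) = to ∈-｛｝ (p′ false)

  b≈x⊎b≈y : b ≈ x ⊎ b ≈ y
  b≈x⊎b≈y with q false
  ... | true  , e = inj₁ (≈-sym (proj₂ (singleton-injective e)))
  ... | false , e = to ∈-｛｝ (proj₁ (≈-sym e) false)

  y≈b : y ≈ b
  y≈b with y≈a⊎y≈b | b≈x⊎b≈y
  ... | inj₂ e | _       = e
  ... | inj₁ _ | inj₂ e  = ≈-sym e
  ... | inj₁ e | inj₁ e′ = ≈-trans e (≈-trans (≈-sym x≈a) (≈-sym e′))

module Classical (em : ExcludedMiddle (lsuc 0ℓ)) where

  em₀ : {P : Set} → Dec P
  em₀ = map′ lower (lift {ℓ = lsuc 0ℓ}) em

  byContradiction : {P : Set₁} → ¬ ¬ P → P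
  byContradiction {P} ¬¬p with em {P}
  ... | yes p = p
  ... | no ¬p = ⊥-elim (¬¬p ¬p)

  byContradiction₀ : {P : Set} → ¬ ¬ P → P
  byContradiction₀ {P} ¬¬p with em₀ {P}
  ... | yes p = p
  ... | no ¬p = ⊥-elim (¬¬p ¬p)

  module Ordinal {κ : 𝕍} (ord : IsOrdinal κ) where

    ∈-trans : i ∈ κ → y ∈ i → z ∈ y → z ∈ i
    ∈-trans i∈κ y∈i z∈y = proj₂ ord _ i∈κ _ y∈i _ z∈y

    ∈-below : i ∈ κ → j ∈ i → j ∈ κ
    ∈-below i∈κ j∈i = proj₁ ord _ i∈κ _ j∈i

    -- Double `∈`-induction: once neither of `i`, `j` belongs to the other, comparing the members of
    -- each with the other one forces them to have the same members.
    trichotomous : i ∈ κ → j ∈ κ → i ∈ j ⊎ i ≈ j ⊎ j ∈ i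
    trichotomous {i} {j} i∈κ j∈κ = compare i (∈-wellFounded i) j (∈-wellFounded j) i∈κ j∈κ
      where
      compare : ∀ i → Acc _∈_ i → ∀ j → Acc _∈_ j → i ∈ κ → j ∈ κ → i ∈ j ⊎ i ≈ j ⊎ j ∈ i
      compare i (acc ri) j (acc rj) i∈κ j∈κ with em₀ {i ∈ j} | em₀ {j ∈ i}
      ... | yes i∈j | _       = inj₁ i∈j
      ... | no _    | yes j∈i = inj₂ (inj₂ j∈i)
      ... | no i∉j  | no j∉i  = inj₂ (inj₁ (⊆-antisym below above))
        where
        below : i ⊆ j
        below z z∈i with compare z (ri z∈i) j (acc rj) (∈-below i∈κ z∈i) j∈κ
        ... | inj₁ z∈j        = z∈j
        ... | inj₂ (inj₁ z≈j) = contradiction (∈-respˡ z≈j z∈i) j∉i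
        ... | inj₂ (inj₂ j∈z) = contradiction (∈-trans i∈κ z∈i j∈z) j∉i

        above : j ⊆ i
        above z z∈j with compare i (acc ri) z (rj z∈j) i∈κ (∈-below j∈κ z∈j)
        ... | inj₁ i∈z        = contradiction (∈-trans j∈κ z∈j i∈z) i∉j
        ... | inj₂ (inj₁ i≈z) = contradiction (∈-respˡ (≈-sym i≈z) z∈j) i∉j
        ... | inj₂ (inj₂ z∈i) = z∈i

    least-unique : {P : 𝕍 → Set} → i ∈ κ → j ∈ κ → P i → P j →
                   (∀ k → k ∈ i → ¬ P k) → (∀ k → k ∈ j → ¬ P k) → i ≈ j
    least-unique i∈κ j∈κ Pi Pj ¬P<i ¬P<j with trichotomous i∈κ j∈κ
    ... | inj₁ i∈j        = contradiction Pi (¬P<j _ i∈j)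
    ... | inj₂ (inj₁ i≈j) = i≈j
    ... | inj₂ (inj₂ j∈i) = contradiction Pj (¬P<i _ j∈i)

separation-unique : {P : 𝕍 → Set ℓ} → x ≈ y → (∀ z → z ∈ S ⇔ (z ∈ x × P z)) →
                    (∀ z → z ∈ T ⇔ (z ∈ y × P z)) → S ≈ T
separation-unique e S-def T-def = ⊆-antisym
  (λ z z∈S → let z∈x , Pz = to (S-def z) z∈S in from (T-def z) (∈-respʳ e z∈x , Pz))
  (λ z z∈T → let z∈y , Pz = to (T-def z) z∈T in from (S-def z) (∈-respʳ (≈-sym e) z∈y , Pz))

rename : (Fin n → Fin k) → Formula n → Formula k
rename r (i ∈′ j) = r i ∈′ r j
rename r (i ≈′ j) = r i ≈′ r j
rename r (¬′ φ)   = ¬′ rename r φ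
rename r (φ ∧′ ψ) = rename r φ ∧′ rename r ψ
rename r (φ ∨′ ψ) = rename r φ ∨′ rename r ψ
rename r (φ ⇒′ ψ) = rename r φ ⇒′ rename r ψ
rename r (∀′ φ)   = ∀′ rename (Fin.lift 1 r) φ
rename r (∃′ φ)   = ∃′ rename (Fin.lift 1 r) φ

-- The environments are matched up to `≈` rather than `≡`, so the case `r = id` also gives
-- invariance of satisfaction under `≈`.
⊨-rename : ∀ {M} (φ : Formula n) {r : Fin n → Fin k} {ρ ρ′} →
           (∀ i → lookup ρ (r i) ≈ lookup ρ′ i) → (M ⊨ rename r φ [ ρ ]) ⇔ (M ⊨ φ [ ρ′ ])
⊨-rename (i ∈′ j) e = mk⇔
  (λ (lift h) → lift (∈-respʳ (e j) (∈-respˡ (e i) h)))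
  (λ (lift h) → lift (∈-respʳ (≈-sym (e j)) (∈-respˡ (≈-sym (e i)) h)))
⊨-rename (i ≈′ j) e = mk⇔
  (λ (lift h) → lift (≈-trans (≈-sym (e i)) (≈-trans h (e j))))
  (λ (lift h) → lift (≈-trans (e i) (≈-trans h (≈-sym (e j)))))
⊨-rename (¬′ φ)   e = ¬-cong-⇔ (⊨-rename φ e)
⊨-rename (φ ∧′ ψ) e = ⊨-rename φ e ×-⇔ ⊨-rename ψ e
⊨-rename (φ ∨′ ψ) e = ⊨-rename φ e ⊎-⇔ ⊨-rename ψ e
⊨-rename (φ ⇒′ ψ) e = →-cong-⇔ (⊨-rename φ e) (⊨-rename ψ e)
⊨-rename (∀′ φ)   e = mk⇔
  (λ h x Mx → to (⊨-rename φ λ { zero → ≈-refl ; (suc i) → e i }) (h x Mx))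
  (λ h x Mx → from (⊨-rename φ λ { zero → ≈-refl ; (suc i) → e i }) (h x Mx))
⊨-rename (∃′ φ)   e = mk⇔
  (λ (x , Mx , h) → x , Mx , to (⊨-rename φ λ { zero → ≈-refl ; (suc i) → e i }) h)
  (λ (x , Mx , h) → x , Mx , from (⊨-rename φ λ { zero → ≈-refl ; (suc i) → e i }) h)

⊨-resp-≈ : ∀ {M} (φ : Formula n) {ρ ρ′} → (∀ i → lookup ρ i ≈ lookup ρ′ i) →
           M ⊨ φ [ ρ ] → M ⊨ φ [ ρ′ ]
⊨-resp-≈ φ {ρ} e = to (⊨-rename φ {r = id} {ρ} e) ∘ from (⊨-rename φ {r = id} {ρ} {ρ} λ _ → ≈-refl)

-- Definability and formation of sets in a transitive model

module Model {M : Class} (isModel : IsModel M) where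
  open IsModel isModel
  open ZFC zfc

  -- P is first-order definable in M; bounded quantifiers over members of
  -- elements of M carry no guard in P, since M is transitive.
  record Definable (P : Vec 𝕍 n → Set ℓ) : Set (lsuc 0ℓ ⊔ ℓ) where
    field
      formula : Formula n
      sound   : ∀ {ρ} → VecAll M ρ → (M ⊨ formula [ ρ ]) ⇔ P ρ
  open Definable public

  private
    variable
      P Q : Vec 𝕍 n → Set ℓ

  mapᵈ : (∀ ρ → VecAll M ρ → P ρ ⇔ Q ρ) → Definable P → Definable Q
  mapᵈ e D .formula = D .formula
  mapᵈ e D .sound Mρ = e _ Mρ ⇔-∘ D .sound Mρ

  infix  5 _∈ᵈ_ _≈ᵈ_
  infixr 4 _∧ᵈ_
  infixr 3 _∨ᵈ_

  _∈ᵈ_ _≈ᵈ_ : ∀ i j → Definable {n} _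
  i ∈ᵈ j = record { formula = i ∈′ j ; sound = λ {ρ} _ →
    mk⇔ {B = lookup ρ i ∈ lookup ρ j} lower lift }
  i ≈ᵈ j = record { formula = i ≈′ j ; sound = λ {ρ} _ →
    mk⇔ {B = lookup ρ i ≈ lookup ρ j} lower lift }

  ¬ᵈ_ : Definable P → Definable (λ ρ → ¬ P ρ)
  (¬ᵈ D) .formula = ¬′ D .formula
  (¬ᵈ D) .sound Mρ = ¬-cong-⇔ (D .sound Mρ)

  _∧ᵈ_ : Definable P → Definable Q → Definable (λ ρ → P ρ × Q ρ)
  (D ∧ᵈ E) .formula = D .formula ∧′ E .formula
  (D ∧ᵈ E) .sound Mρ = D .sound Mρ ×-⇔ E .sound Mρ

  _∨ᵈ_ : Definable P → Definable Q → Definable (λ ρ → P ρ ⊎ Q ρ)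
  (D ∨ᵈ E) .formula = D .formula ∨′ E .formula
  (D ∨ᵈ E) .sound Mρ = D .sound Mρ ⊎-⇔ E .sound Mρ

  _⇒ᵈ_ : Definable P → Definable Q → Definable (λ ρ → P ρ → Q ρ)
  (D ⇒ᵈ E) .formula = D .formula ⇒′ E .formula
  (D ⇒ᵈ E) .sound Mρ = →-cong-⇔ (D .sound Mρ) (E .sound Mρ)

  ∃∈ᵈ : ∀ i → Definable P → Definable (λ ρ → ∃ λ x → x ∈ lookup ρ i × P (x ∷ ρ))
  ∃∈ᵈ i D .formula = ∃′ ((zero ∈′ suc i) ∧′ D .formula)
  ∃∈ᵈ i D .sound Mρ = mk⇔
    (λ (x , Mx , lift x∈i , h) → x , x∈i , to (D .sound (Mx ∷ Mρ)) h)
    (λ (x , x∈i , h) → let Mx = transitive x∈i (lookup⁺ Mρ i) in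
      x , Mx , lift x∈i , from (D .sound (Mx ∷ Mρ)) h)

  ∀∈ᵈ : ∀ i → Definable P → Definable (λ ρ → ∀ x → x ∈ lookup ρ i → P (x ∷ ρ))
  ∀∈ᵈ i D .formula = ∀′ ((zero ∈′ suc i) ⇒′ D .formula)
  ∀∈ᵈ i D .sound Mρ = mk⇔
    (λ h x x∈i → let Mx = transitive x∈i (lookup⁺ Mρ i) in
      to (D .sound (Mx ∷ Mρ)) (h x Mx (lift x∈i)))
    (λ h x Mx (lift x∈i) → from (D .sound (Mx ∷ Mρ)) (h x x∈i))

  ≈｛｝ᵈ : ∀ i j k → Definable {n} (λ ρ → lookup ρ i ≈ ｛ lookup ρ j , lookup ρ k ｝)
  ≈｛｝ᵈ i j k = mapᵈ
    (λ ρ _ → mk⇔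
      (λ (j∈i , k∈i , h) → ⊆-antisym
        (λ z z∈i → from ∈-｛｝ (h z z∈i))
        (λ z z∈｛｝ → [ (λ e → ∈-respˡ (≈-sym e) j∈i) , (λ e → ∈-respˡ (≈-sym e) k∈i) ] (to ∈-｛｝ z∈｛｝)))
      (λ e → ∈-respʳ (≈-sym e) x∈｛x,y｝ , ∈-respʳ (≈-sym e) y∈｛x,y｝
           , λ z z∈i → to ∈-｛｝ (∈-respʳ e z∈i)))
    (j ∈ᵈ i ∧ᵈ k ∈ᵈ i ∧ᵈ ∀∈ᵈ i (0F ≈ᵈ suc j ∨ᵈ 0F ≈ᵈ suc k))

  ≈⟨⟩ᵈ : ∀ i j k → Definable {n} (λ ρ → lookup ρ i ≈ ⟨ lookup ρ j , lookup ρ k ⟩)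
  ≈⟨⟩ᵈ i j k = mapᵈ
    (λ ρ _ → mk⇔
      (λ (u , u∈i , v , v∈i , eu , ev , e) → ≈-trans e (｛｝-cong eu ev))
      (λ e → _ , ∈-respʳ (≈-sym e) x∈｛x,y｝ , _ , ∈-respʳ (≈-sym e) y∈｛x,y｝ , ≈-refl , ≈-refl , e))
    (∃∈ᵈ i (∃∈ᵈ (suc i)
      (≈｛｝ᵈ 1F (suc (suc j)) (suc (suc j)) ∧ᵈ ≈｛｝ᵈ 0F (suc (suc j)) (suc (suc k))
        ∧ᵈ ≈｛｝ᵈ (suc (suc i)) 1F 0F)))

  ⟨⟩∈ᵈ : ∀ i j k → Definable {n} (λ ρ → ⟨ lookup ρ i , lookup ρ j ⟩ ∈ lookup ρ k)
  ⟨⟩∈ᵈ i j k = mapᵈ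
    (λ ρ _ → mk⇔ (λ (p , p∈k , e) → ∈-respˡ e p∈k) (λ h → _ , h , ≈-refl))
    (∃∈ᵈ k (≈⟨⟩ᵈ 0F (suc i) (suc j)))

  M-⟨⟩ : M ⟨ x , y ⟩ → M x × M y
  M-⟨⟩ M⟨⟩ = transitive x∈｛x,y｝ M｛｝ , transitive y∈｛x,y｝ M｛｝
    where M｛｝ = transitive y∈｛x,y｝ M⟨⟩

  -- The quantifier is bounded in disguise: `y` lies in the transitive closure of the set at `f`,
  -- hence in `M`.
  ∃⟨⟩∈ᵈ : ∀ i f → Definable P →
          Definable (λ ρ → ∃ λ y → ⟨ lookup ρ i , y ⟩ ∈ lookup ρ f × P (y ∷ ρ))
  ∃⟨⟩∈ᵈ i f D .formula = ∃′ (⟨⟩∈ᵈ (suc i) zero (suc f) .formula ∧′ D .formula)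
  ∃⟨⟩∈ᵈ i f D .sound Mρ = mk⇔
    (λ (y , My , h , h′) → y , to (⟨⟩∈ᵈ (suc i) zero (suc f) .sound (My ∷ Mρ)) h , to (D .sound (My ∷ Mρ)) h′)
    (λ (y , h , h′) → let My = proj₂ (M-⟨⟩ (transitive h (lookup⁺ Mρ f))) in
      y , My , from (⟨⟩∈ᵈ (suc i) zero (suc f) .sound (My ∷ Mρ)) h , from (D .sound (My ∷ Mρ)) h′)

  ≈separateᵈ : ∀ i j → Definable P →
    Definable (λ ρ → ∀ x → x ∈ lookup ρ i ⇔ (x ∈ lookup ρ j × P (x ∷ ρ)))
  ≈separateᵈ i j D = mapᵈ
    (λ ρ _ → mk⇔ (λ (h , h′) x → mk⇔ (h x) (uncurry (h′ x)))
                 (λ h → (λ x → to (h x)) , (λ x x∈j Px → from (h x) (x∈j , Px))))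
    (∀∈ᵈ i (0F ∈ᵈ suc j ∧ᵈ D) ∧ᵈ ∀∈ᵈ j (D ⇒ᵈ (0F ∈ᵈ suc i)))

  M-｛｝ : M x → M y → M ｛ x , y ｝
  M-｛｝ {x} {y} Mx My =
    let p , Mp , p-def = pairing x y Mx My
    in respects (⊆-antisym (λ z z∈p → from ∈-｛｝ (to (p-def z (transitive z∈p Mp)) z∈p))
                           (λ z z∈｛｝ → from (p-def z (M-∈ z∈｛｝)) (to ∈-｛｝ z∈｛｝))) Mp
    where
    M-∈ : z ∈ ｛ x , y ｝ → M z
    M-∈ z∈ = [ (λ e → respects (≈-sym e) Mx) , (λ e → respects (≈-sym e) My) ] (to ∈-｛｝ z∈)

  M-pair : M x → M y → M ⟨ x , y ⟩
  M-pair Mx My = M-｛｝ (M-｛｝ Mx Mx) (M-｛｝ Mx My)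

  abstract
    unions : M x → ∃ λ u → M u × (∀ z → z ∈ u ⇔ (∃ λ y → y ∈ x × z ∈ y))
    unions {x} Mx = let u , Mu , u-def = union x Mx in u , Mu , λ z → mk⇔
      (λ z∈u → to (u-def z (transitive z∈u Mu)) z∈u)
      (λ h → from (u-def z (let y , y∈x , z∈y = h in transitive z∈y (transitive y∈x Mx))) h)

  abstract
    separate : Definable P → ∀ {ps : Vec 𝕍 n} → VecAll M ps → M x →
               ∃ λ s → M s × (∀ z → z ∈ s ⇔ (z ∈ x × P (z ∷ ps)))
    separate {x = x} D Mps Mx =
      let s , Ms , s-def = separation (D .formula) _ Mps x Mx in s , Ms , λ z → mk⇔
        (λ z∈s → let Mz = transitive z∈s Ms ; z∈x , h = to (s-def z Mz) z∈s in
          z∈x , to (D .sound (Mz ∷ Mps)) h)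
        (λ (z∈x , h) → let Mz = transitive z∈x Mx in
          from (s-def z Mz) (z∈x , from (D .sound (Mz ∷ Mps)) h))

  record FunctionOn (d : 𝕍) (P : 𝕍 → 𝕍 → Set ℓ) : Set (lsuc 0ℓ ⊔ ℓ) where
    field
      graph      : 𝕍
      M-graph    : M graph
      isFunction : IsFunctionOn d graph
      value      : ∀ {x y} → ⟨ x , y ⟩ ∈ graph → P x y
      ∈-graph    : ∀ {x y} → x ∈ d → M y → P x y → ⟨ x , y ⟩ ∈ graph
  open FunctionOn public

  abstract
    -- Replacement is applied to a formula describing the pair `⟨ x , y ⟩` instead of `y`, so that
    -- it yields a graph. Its quantifier puts `y` in front of `x` and the pair, whereas `D` expects
    -- `x` before `y`; `swap` repairs the order.
    function : Definable P → ∀ {ps : Vec 𝕍 n} → VecAll M ps → M d →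
               (∀ x → x ∈ d → ∃ λ y → M y × P (x ∷ y ∷ ps)) →
               (∀ {x y z} → x ∈ d → M y → M z → P (x ∷ y ∷ ps) → P (x ∷ z ∷ ps) → y ≈ z) →
               FunctionOn d (λ x y → P (x ∷ y ∷ ps))
    function {n = n} {P = P} {d = d} D {ps} Mps Md total functional =
      fromReplacement (replacement φ ps Mps d Md λ x p q x∈d Mp Mq h h′ →
        let Mx = transitive x∈d Md
            y , My , Pxy , e  = to (φ-sound Mx Mp) h
            z , Mz , Pxz , e′ = to (φ-sound Mx Mq) h′
        in ≈-trans e (≈-trans (⟨⟩-cong ≈-refl (functional x∈d My Mz Pxy Pxz)) (≈-sym e′)))
      where
      swap : Fin (suc (suc n)) → Fin (suc (suc (suc n)))
      swap zero          = 1F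
      swap (suc zero)    = 0F
      swap (suc (suc i)) = suc (suc (suc i))

      φ : Formula (suc (suc n))
      φ = ∃′ (rename swap (D .formula) ∧′ ≈⟨⟩ᵈ 2F 1F 0F .formula)

      φ-sound : ∀ {x p} → M x → M p →
                (M ⊨ φ [ x ∷ p ∷ ps ]) ⇔ (∃ λ y → M y × P (x ∷ y ∷ ps) × p ≈ ⟨ x , y ⟩)
      φ-sound Mx Mp = mk⇔
        (λ (y , My , h , e) → y , My
          , to (D .sound (Mx ∷ My ∷ Mps)) (to (⊨-rename (D .formula) swap-env) h)
          , to (≈⟨⟩ᵈ 2F 1F 0F .sound (My ∷ Mx ∷ Mp ∷ Mps)) e)
        (λ (y , My , h , e) → y , My
          , from (⊨-rename (D .formula) swap-env) (from (D .sound (Mx ∷ My ∷ Mps)) h)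
          , from (≈⟨⟩ᵈ 2F 1F 0F .sound (My ∷ Mx ∷ Mp ∷ Mps)) e)
        where
        swap-env : ∀ {x y p} i → lookup (y ∷ x ∷ p ∷ ps) (swap i) ≈ lookup (x ∷ y ∷ ps) i
        swap-env zero          = ≈-refl
        swap-env (suc zero)    = ≈-refl
        swap-env (suc (suc i)) = ≈-refl

      fromReplacement : (∃ λ g → M g × (∀ p → M p → p ∈ g ⇔ (∃ λ x → x ∈ d × (M ⊨ φ [ x ∷ p ∷ ps ])))) →
                        FunctionOn d (λ x y → P (x ∷ y ∷ ps))
      fromReplacement (g , Mg , g-def) = record
        { graph      = g
        ; M-graph    = Mg
        ; isFunction = pairs , λ x x∈d →
            let y , My , h = total x x∈d in
            y , ∈-g x∈d My h , λ h′ → functional x∈d My (proj₂ (M-⟨⟩ (transitive h′ Mg))) h (value-g h′)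
        ; value      = value-g
        ; ∈-graph    = ∈-g
        }
        where
        members : p ∈ g → ∃₂ λ x y → x ∈ d × M y × P (x ∷ y ∷ ps) × p ≈ ⟨ x , y ⟩
        members {p} p∈g =
          let Mp = transitive p∈g Mg
              x , x∈d , h = to (g-def p Mp) p∈g
              y , h′ = to (φ-sound (transitive x∈d Md) Mp) h
          in x , y , x∈d , h′

        pairs : ∀ p → p ∈ g → ∃₂ λ x y → x ∈ d × p ≈ ⟨ x , y ⟩
        pairs p p∈g = let x , y , x∈d , _ , _ , e = members p∈g in x , y , x∈d , e

        value-g : ⟨ x , y ⟩ ∈ g → P (x ∷ y ∷ ps)
        value-g {x} {y} h =
          let x′ , y′ , x′∈d , My′ , h′ , e = members h
              ex , ey = ⟨⟩-injective e
              Mx , My = M-⟨⟩ (transitive h Mg)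
          -- `P` itself is not assumed to respect `≈`, but the formula defining it does; hence the
          -- detour through satisfaction.
          in to (D .sound (Mx ∷ My ∷ Mps)) (⊨-resp-≈ (D .formula)
               (λ { zero → ≈-sym ex ; (suc zero) → ≈-sym ey ; (suc (suc i)) → ≈-refl })
               (from (D .sound (transitive x′∈d Md ∷ My′ ∷ Mps)) h′))

        ∈-g : x ∈ d → M y → P (x ∷ y ∷ ps) → ⟨ x , y ⟩ ∈ g
        ∈-g x∈d My h =
          let Mx = transitive x∈d Md ; Mp = M-pair Mx My
          in from (g-def _ Mp) (_ , x∈d , from (φ-sound Mx Mp) (_ , My , h , ≈-refl))

  abstract
    range : IsFunctionOn d f → M d → M f → ∃ λ r → M r × (∀ y → y ∈ r ⇔ (∃ λ x → ⟨ x , y ⟩ ∈ f))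
    range {d} {f} (pairs , fun) Md Mf =
      let r , Mr , r-def = replacement (⟨⟩∈ᵈ 0F 1F 2F .formula) (f ∷ []) (Mf ∷ []) d Md
            λ x y z x∈d My Mz h h′ →
              let Mx = transitive x∈d Md ; _ , _ , unique = fun x x∈d in
              ≈-trans (≈-sym (unique (to (⟨⟩∈ᵈ 0F 1F 2F .sound (Mx ∷ My ∷ Mf ∷ [])) h)))
                      (unique (to (⟨⟩∈ᵈ 0F 1F 2F .sound (Mx ∷ Mz ∷ Mf ∷ [])) h′))
      in r , Mr , λ y → mk⇔
        (λ y∈r →
          let My = transitive y∈r Mr ; x , x∈d , h = to (r-def y My) y∈r
          in x , to (⟨⟩∈ᵈ 0F 1F 2F .sound (transitive x∈d Md ∷ My ∷ Mf ∷ [])) h)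
        (λ (x , h) →
          let Mx , My = M-⟨⟩ (transitive h Mf) ; _ , _ , x′∈d , e = pairs _ h
              x∈d = ∈-respˡ (≈-sym (proj₁ (⟨⟩-injective e))) x′∈d
          in from (r-def y My) (x , x∈d , from (⟨⟩∈ᵈ 0F 1F 2F .sound (Mx ∷ My ∷ Mf ∷ [])) h))

-- Families indexed by κ

∈-singleton : z ∈ ｛ x , x ｝ ⇔ z ≈ x
∈-singleton {z} {x} = mk⇔ (λ h → [ id , id ] (to (∈-｛｝ {z} {x} {x}) h)) (λ e → from (∈-｛｝ {z} {x} {x}) (inj₁ e))

singleton-function : ⟨ x , y ⟩ ∈ ｛ ⟨ a , b ⟩ , ⟨ a , b ⟩ ｝ ⇔ (x ≈ a × y ≈ b)
singleton-function {x} {y} {a} {b} = mk⇔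
  (λ h → ⟨⟩-injective (to (∈-singleton {⟨ x , y ⟩} {⟨ a , b ⟩}) h))
  (λ (e , e′) → from (∈-singleton {⟨ x , y ⟩} {⟨ a , b ⟩}) (⟨⟩-cong e e′))

module FunctionProperties {d f : 𝕍} (isFunction : IsFunctionOn d f) where

  dom : ⟨ x , y ⟩ ∈ f → x ∈ d
  dom h = let _ , _ , x′∈d , e = proj₁ isFunction _ h in ∈-respˡ (≈-sym (proj₁ (⟨⟩-injective e))) x′∈d

  total : x ∈ d → ∃ λ y → ⟨ x , y ⟩ ∈ f
  total x∈d = let y , h , _ = proj₂ isFunction _ x∈d in y , h

  unique : ⟨ x , y ⟩ ∈ f → ⟨ x , z ⟩ ∈ f → y ≈ z
  unique h h′ = let _ , _ , uniq = proj₂ isFunction _ (dom h) in ≈-trans (≈-sym (uniq h)) (uniq h′)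

Before : 𝕍 → 𝕍 → 𝕍 → Set₁
Before N i m = ∃ λ j → j ∈ i × ∃ λ T → ⟨ j , T ⟩ ∈ N × m ∈ T

module Families (em : ExcludedMiddle (lsuc 0ℓ)) {M : Class} (isModel : IsModel M)
                {κ : 𝕍} (M-κ : M κ) (ordinal : IsOrdinal κ) (infinite : Infinite κ) where
  open IsModel isModel
  open Model isModel
  open Classical em
  open Ordinal ordinal

  abstract
    least : ∃ λ o → o ∈ κ × (∀ j → j ∈ o → j ∉ κ)
    least = byContradiction (¬¬minimal (_∈ κ) (byContradiction λ none →
      infinite ([] , λ z z∈κ → contradiction (z , z∈κ) none)))

  -- Index zero of `κ`, obtained as a minimal element. Nothing precedes it, and being empty it also
  -- serves as the empty set of `M`.
  o : 𝕍
  o = proj₁ least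

  o∈κ : o ∈ κ
  o∈κ = proj₁ (proj₂ least)

  o-empty : Empty o
  o-empty j j∈o = proj₂ (proj₂ least) j j∈o (∈-below o∈κ j∈o)

  abstract
    nonzero : ∃ λ i → i ∈ κ × i ∉ ｛ o , o ｝
    nonzero = byContradiction λ none → infinite (o ∷ [] , λ z z∈κ →
      here (byContradiction₀ λ z≉o → none (z , z∈κ , z≉o ∘ to ∈-singleton)))

  abstract
    ⋃-family : M f → IsFunctionOn κ f →
               ∃ λ U → M U × (∀ m → m ∈ U ⇔ (∃₂ λ i S → ⟨ i , S ⟩ ∈ f × m ∈ S))
    ⋃-family Mf fun =
      let r , Mr , r-def = range fun M-κ Mf ; U , MU , U-def = unions Mr in
      U , MU , λ m → mk⇔
        (λ m∈U → let S , S∈r , m∈S = to (U-def m) m∈U ; i , h = to (r-def S) S∈r in i , S , h , m∈S)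
        (λ (i , S , h , m∈S) → from (U-def m) (S , from (r-def S) (i , h) , m∈S))

  abstract
    -- A family has to have domain exactly `κ`, so a family known on `c` is padded with the default
    -- `b`. This produces pairs (`c` holds only `o`) and initial segments (`c` is an index).
    ifᶠ : M f → M c → M b →
          (∀ {k} → k ∈ κ → k ∈ c → ∃ λ y → ⟨ k , y ⟩ ∈ f) →
          (∀ {k y z} → ⟨ k , y ⟩ ∈ f → ⟨ k , z ⟩ ∈ f → y ≈ z) →
          FunctionOn κ λ k y → (k ∈ c × ⟨ k , y ⟩ ∈ f) ⊎ (k ∉ c × y ≈ b)
    ifᶠ {f} {c} {b} Mf Mc Mb total unique =
      function (0F ∈ᵈ 3F ∧ᵈ ⟨⟩∈ᵈ 0F 1F 2F ∨ᵈ (¬ᵈ (0F ∈ᵈ 3F)) ∧ᵈ 1F ≈ᵈ 4F)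
        {f ∷ c ∷ b ∷ []} (Mf ∷ Mc ∷ Mb ∷ []) M-κ value′ functional
      where
      value′ : ∀ k → k ∈ κ → ∃ λ y → M y × ((k ∈ c × ⟨ k , y ⟩ ∈ f) ⊎ (k ∉ c × y ≈ b))
      value′ k k∈κ with em₀ {k ∈ c}
      ... | yes k∈c = let y , h = total k∈κ k∈c in
                      y , proj₂ (M-⟨⟩ (transitive h Mf)) , inj₁ (k∈c , h)
      ... | no k∉c  = b , Mb , inj₂ (k∉c , ≈-refl)

      functional : ∀ {k y z} → k ∈ κ → M y → M z →
                   (k ∈ c × ⟨ k , y ⟩ ∈ f) ⊎ (k ∉ c × y ≈ b) →
                   (k ∈ c × ⟨ k , z ⟩ ∈ f) ⊎ (k ∉ c × z ≈ b) → y ≈ z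
      functional _ _ _ (inj₁ (_ , h))   (inj₁ (_ , h′))   = unique h h′
      functional _ _ _ (inj₁ (k∈c , _)) (inj₂ (k∉c , _))  = contradiction k∈c k∉c
      functional _ _ _ (inj₂ (k∉c , _)) (inj₁ (k∈c , _))  = contradiction k∈c k∉c
      functional _ _ _ (inj₂ (_ , e))   (inj₂ (_ , e′))   = ≈-trans e (≈-sym e′)

  -- The field `first` matters for monotonicity of the measure: the entry at index `o` loses nothing
  -- when the family is made disjoint.
  record Doubleton (a b : 𝕍) : Set₁ where
    field
      graph      : 𝕍
      M-graph    : M graph
      isFunction : IsFunctionOn κ graph
      first      : ⟨ o , a ⟩ ∈ graph
      values     : ∀ {y} → (∃ λ i → ⟨ i , y ⟩ ∈ graph) ⇔ (y ≈ a ⊎ y ≈ b)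

  abstract
    doubleton : M a → M b → Doubleton a b
    doubleton {a} {b} Ma Mb = record
      { graph      = g .graph
      ; M-graph    = g .M-graph
      ; isFunction = g .isFunction
      ; first      = first-value ≈-refl
      ; values     = mk⇔ only values-∈
      }
      where
      M-o : M o
      M-o = transitive o∈κ M-κ

      M-oa : M ⟨ o , a ⟩
      M-oa = M-pair M-o Ma

      g : FunctionOn κ λ k y → (k ∈ ｛ o , o ｝ × ⟨ k , y ⟩ ∈ ｛ ⟨ o , a ⟩ , ⟨ o , a ⟩ ｝) ⊎ (k ∉ ｛ o , o ｝ × y ≈ b)
      g = ifᶠ (M-｛｝ M-oa M-oa) (M-｛｝ M-o M-o) Mb
        (λ _ k∈0 → a , from singleton-function (to ∈-singleton k∈0 , ≈-refl))
        (λ h h′ → ≈-trans (proj₂ (to singleton-function h)) (≈-sym (proj₂ (to singleton-function h′))))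

      only : ∀ {y} → (∃ λ i → ⟨ i , y ⟩ ∈ g .graph) → y ≈ a ⊎ y ≈ b
      only {y} (i , h) = Sum.map
        (λ (_ , h′) → proj₂ (to (singleton-function {i} {y} {o} {a}) h′)) proj₂ (g .value h)

      first-value : ∀ {y} → y ≈ a → ⟨ o , y ⟩ ∈ g .graph
      first-value e = g .∈-graph o∈κ (respects (≈-sym e) Ma)
        (inj₁ (x∈｛x,y｝ , from singleton-function (≈-refl , e)))

      values-∈ : ∀ {y} → y ≈ a ⊎ y ≈ b → ∃ λ i → ⟨ i , y ⟩ ∈ g .graph
      values-∈ (inj₁ e) = o , first-value e
      values-∈ (inj₂ e) = let i , i∈κ , i∉0 = nonzero in
        i , g .∈-graph i∈κ (respects (≈-sym e) Mb) (inj₂ (i∉0 , e))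

  -- A member of the range is sent to the least index at which it is attained.
  abstract
    range-injects : M f → IsFunctionOn κ f → ∀ {r} → M r → (∀ y → y ∈ r ⇔ (∃ λ i → ⟨ i , y ⟩ ∈ f)) →
      ∃ λ h → M h × IsFunctionOn r h × (∀ y i → ⟨ y , i ⟩ ∈ h → i ∈ κ)
            × (∀ y z i → ⟨ y , i ⟩ ∈ h → ⟨ z , i ⟩ ∈ h → y ≈ z)
    range-injects {f} Mf fun {r} Mr r-def =
      h .graph , h .M-graph , h .isFunction
      , (λ y i yi → dom (proj₁ (h .value yi)))
      , (λ y z i yi zi → unique (proj₁ (h .value yi)) (proj₁ (h .value zi)))
      where
      open FunctionProperties fun

      h : FunctionOn r λ y i → ⟨ i , y ⟩ ∈ f × (∀ j → j ∈ i → ⟨ j , y ⟩ ∉ f)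
      h = function (⟨⟩∈ᵈ 1F 0F 2F ∧ᵈ ∀∈ᵈ 1F (¬ᵈ ⟨⟩∈ᵈ 0F 1F 3F)) {f ∷ []} (Mf ∷ []) Mr
        (λ y y∈r → let i , yi , i-least = byContradiction (¬¬minimal (λ i → ⟨ i , y ⟩ ∈ f) (to (r-def y) y∈r)) in
          i , proj₁ (M-⟨⟩ (transitive yi Mf)) , yi , i-least)
        (λ {y} _ _ _ (h , l) (h′ , l′) → least-unique {P = λ i → ⟨ i , y ⟩ ∈ f} (dom h) (dom h′) h h′ l l′)

  abstract
    -- Each entry keeps only those points that occur in no earlier entry. The result has to be a set
    -- of `M`, because additivity quantifies over families in the model.
    disjointify : M N → IsFunctionOn κ N →
      FunctionOn κ λ i S → ∃ λ T → ⟨ i , T ⟩ ∈ N × (∀ m → m ∈ S ⇔ (m ∈ T × ¬ Before N i m))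
    disjointify {N} MN fun =
      function (∃⟨⟩∈ᵈ 0F 2F (≈separateᵈ 2F 0F (¬ᵈ ∃∈ᵈ 2F (∃⟨⟩∈ᵈ 0F 5F (2F ∈ᵈ 0F))))) {N ∷ []} (MN ∷ []) M-κ
        (λ i i∈κ →
          let T , h = total i∈κ
              S , MS , S-def = separate (¬ᵈ ∃∈ᵈ 1F (∃⟨⟩∈ᵈ 0F 3F (2F ∈ᵈ 0F))) {i ∷ N ∷ []}
                                 (transitive i∈κ M-κ ∷ MN ∷ []) (proj₂ (M-⟨⟩ (transitive h MN)))
          in S , MS , T , h , S-def)
        (λ _ _ _ (T , h , S-def) (T′ , h′ , S-def′) → separation-unique (unique h h′) S-def S-def′)
      where open FunctionProperties fun

  abstract
    -- Turns a family of codes into the family of their interpretations (`g` will be `Int`),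
    -- localised to `S`; the localisation lets a cover of `S` be treated as a union equal to `S`.
    meets : M f → IsFunctionOn κ f → ∀ {d g} → M g → IsFunctionOn d g → (∀ {i x} → ⟨ i , x ⟩ ∈ f → x ∈ d) → M S →
      FunctionOn κ λ i R → ∃ λ x → ⟨ i , x ⟩ ∈ f × ∃ λ T → ⟨ x , T ⟩ ∈ g × (∀ m → m ∈ R ⇔ (m ∈ T × m ∈ S))
    meets {f} {S} Mf fun {d} {g} Mg gun f⊆d MS =
      function (∃⟨⟩∈ᵈ 0F 2F (∃⟨⟩∈ᵈ 0F 4F (≈separateᵈ 3F 0F (0F ∈ᵈ 7F)))) {f ∷ g ∷ S ∷ []} (Mf ∷ Mg ∷ MS ∷ []) M-κ
        (λ i i∈κ →
          let x , h = F.total i∈κ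
              T , h′ = G.total (f⊆d h)
              R , MR , R-def = separate (0F ∈ᵈ 1F) {S ∷ []} (MS ∷ []) (proj₂ (M-⟨⟩ (transitive h′ Mg)))
          in R , MR , x , h , T , h′ , R-def)
        (λ _ _ _ (x , h , T , k , R-def) (x′ , h′ , T′ , k′ , R-def′) →
          separation-unique (G.unique (∈-respˡ (⟨⟩-cong (F.unique h h′) ≈-refl) k) k′) R-def R-def′)
      where
      module F = FunctionProperties fun
      module G = FunctionProperties gun

  abstract
    negations : M f → IsFunctionOn κ f → M (# 1) →
      FunctionOn κ λ i y → ∃ λ γ → ⟨ i , γ ⟩ ∈ f × y ≈ ¬ᶜ γ
    negations {f} Mf fun M-1 =
      function (∃⟨⟩∈ᵈ 0F 2F (≈⟨⟩ᵈ 2F 4F 0F)) {f ∷ # 1 ∷ []} (Mf ∷ M-1 ∷ []) M-κ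
        (λ i i∈κ → let γ , h = total i∈κ in
          ¬ᶜ γ , M-pair M-1 (proj₂ (M-⟨⟩ (transitive h Mf))) , γ , h , ≈-refl)
        (λ _ _ _ (γ , h , e) (γ′ , h′ , e′) →
          ≈-trans e (≈-trans (⟨⟩-cong ≈-refl (unique h h′)) (≈-sym e′)))
      where open FunctionProperties fun

-- Borel codes and their interpretation inside one model

module Codes (em : ExcludedMiddle (lsuc 0ℓ)) {M : Class} (isModel : IsModel M)
             {κ X L : 𝕍} (B : BorelCodes κ X L M) where
  open IsModel isModel
  open Model isModel
  open Classical em
  open BorelCodes B
  open CodeClosed (proj₁ (proj₂ 𝔹-def)) public
  open FunctionProperties Int-fun public
    renaming (dom to Int-dom; total to Int-total; unique to Int-unique)

  M-𝔹 : M 𝔹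
  M-𝔹 = proj₁ 𝔹-def

  data Shape (c : 𝕍) : Set₁ where
    basic : IsBasicCode κ X L c → Shape c
    neg   : γ ∈ 𝔹 → c ≈ ¬ᶜ γ → Shape c
    join  : M Γ → IsFamily κ X L M Γ → Γ ⊆ 𝔹 → c ≈ ⋁ᶜ Γ → Shape c
    meet  : M Γ → IsFamily κ X L M Γ → Γ ⊆ 𝔹 → c ≈ ⋀ᶜ Γ → Shape c

  -- Otherwise 𝔹 ∖ {c} would be a smaller closed set.
  abstract
    shape : c ∈ 𝔹 → Shape c
    shape {c} c∈𝔹 = byContradiction λ ¬shape →
      let 𝔹∖c , M-𝔹∖c , def = separate (¬ᵈ (0F ≈ᵈ 1F)) {c ∷ []} (transitive c∈𝔹 M-𝔹 ∷ []) M-𝔹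
          ⊆𝔹 = λ z → proj₁ ∘ to (def z)
          closed = record
            { basic-closed = λ c′ bas → from (def c′)
                (basic-closed c′ bas , λ e → ¬shape (basic (resp-basic e bas)))
            ; ¬-closed = λ γ γ∈ → from (def _)
                (¬-closed γ (⊆𝔹 γ γ∈) , λ e → ¬shape (neg (⊆𝔹 γ γ∈) (≈-sym e)))
            ; ⋁-closed = λ Γ MΓ fam Γ⊆ → from (def _)
                (⋁-closed Γ MΓ fam (λ z → ⊆𝔹 z ∘ Γ⊆ z) , λ e → ¬shape (join MΓ fam (λ z → ⊆𝔹 z ∘ Γ⊆ z) (≈-sym e)))
            ; ⋀-closed = λ Γ MΓ fam Γ⊆ → from (def _)
                (⋀-closed Γ MΓ fam (λ z → ⊆𝔹 z ∘ Γ⊆ z) , λ e → ¬shape (meet MΓ fam (λ z → ⊆𝔹 z ∘ Γ⊆ z) (≈-sym e)))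
            }
      in proj₂ (to (def c) (proj₂ (proj₂ 𝔹-def) 𝔹∖c M-𝔹∖c closed c c∈𝔹)) ≈-refl
      where
      resp-basic : x ≈ y → IsBasicCode κ X L x → IsBasicCode κ X L y
      resp-basic e (n , φ , a , aX , e′) = n , φ , a , aX , ≈-trans (≈-sym e) e′

  -- `P` need not define a set of `M`, so minimality of `𝔹` cannot be applied to it. Instead `shape`
  -- inverts a code, and its immediate subcodes lie in the transitive closure of the pair that
  -- encodes it, where `∈` is well-founded.
  𝔹-induction : (P : 𝕍 → Set ℓ) → (∀ {γ ζ} → γ ≈ ζ → P γ → P ζ) →
    (∀ {n} (φ : Conjunction L n) a → a FromSet X → P (basicᶜ φ a)) →
    (∀ {γ} → γ ∈ 𝔹 → P γ → P (¬ᶜ γ)) →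
    (∀ {Γ} → M Γ → IsFamily κ X L M Γ → Γ ⊆ 𝔹 → (∀ {γ} → γ ∈ Γ → P γ) → P (⋁ᶜ Γ)) →
    (∀ {Γ} → M Γ → IsFamily κ X L M Γ → Γ ⊆ 𝔹 → (∀ {γ} → γ ∈ Γ → P γ) → P (⋀ᶜ Γ)) →
    ∀ {γ} → γ ∈ 𝔹 → P γ
  𝔹-induction P resp P-basic P-¬ P-⋁ P-⋀ {γ} =
    All.wfRec (TransClosure.wellFounded _∈_ ∈-wellFounded) _ (λ γ → γ ∈ 𝔹 → P γ) step γ
    where
    step : ∀ c → (∀ {γ} → TransClosure _∈_ γ c → γ ∈ 𝔹 → P γ) → c ∈ 𝔹 → P c
    step c rec c∈𝔹 with shape c∈𝔹
    ... | basic (n , φ , a , aX , e) = resp (≈-sym e) (P-basic φ a aX)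
    ... | neg γ∈𝔹 e = resp (≈-sym e) (P-¬ γ∈𝔹
          (rec (y∈｛x,y｝ TransClosure.∷ TransClosure.[ ∈-respʳ (≈-sym e) y∈｛x,y｝ ]) γ∈𝔹))
    ... | join MΓ fam Γ⊆𝔹 e = resp (≈-sym e) (P-⋁ MΓ fam Γ⊆𝔹 λ γ∈Γ →
          rec (γ∈Γ TransClosure.∷ y∈｛x,y｝ TransClosure.∷ TransClosure.[ ∈-respʳ (≈-sym e) y∈｛x,y｝ ])
            (Γ⊆𝔹 _ γ∈Γ))
    ... | meet MΓ fam Γ⊆𝔹 e = resp (≈-sym e) (P-⋀ MΓ fam Γ⊆𝔹 λ γ∈Γ →
          rec (γ∈Γ TransClosure.∷ y∈｛x,y｝ TransClosure.∷ TransClosure.[ ∈-respʳ (≈-sym e) y∈｛x,y｝ ])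
            (Γ⊆𝔹 _ γ∈Γ))

  ∈Int-resp-≈ : x ≈ y → γ ≈ ζ → x ∈Int γ → y ∈Int ζ
  ∈Int-resp-≈ e e′ (S , h , x∈S) = S , ∈-respˡ (⟨⟩-cong e′ ≈-refl) h , ∈-respˡ e x∈S

  ∈Int⇔∈ : ⟨ γ , S ⟩ ∈ Int → m ∈Int γ ⇔ m ∈ S
  ∈Int⇔∈ h = mk⇔ (λ (T , h′ , m∈T) → ∈-respʳ (Int-unique h′ h) m∈T) (λ m∈S → _ , h , m∈S)

  ∈Int-basic : ∀ {n} {φ : Conjunction L n} {a} → a FromSet X →
               m ∈Int basicᶜ φ a ⇔ (m ∈ Str × SatConjunction m φ a)
  ∈Int-basic {m} {φ = φ} {a} aX =
    let S , h = Int-total (basic-closed _ (_ , φ , a , aX , ≈-refl)) in Int-basic φ a S aX h m ⇔-∘ ∈Int⇔∈ h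

  ∈Int-¬ : γ ∈ 𝔹 → m ∈Int ¬ᶜ γ ⇔ (m ∈ Str × ¬ m ∈Int γ)
  ∈Int-¬ {γ} {m} γ∈𝔹 =
    let S , h = Int-total γ∈𝔹 ; T , h′ = Int-total (¬-closed _ γ∈𝔹)
        neg-def = Int-neg γ S T h h′ m ⇔-∘ ∈Int⇔∈ h′
    in mk⇔ (λ m∈ → let m∈Str , m∉S = to neg-def m∈ in m∈Str , m∉S ∘ to (∈Int⇔∈ h))
           (λ (m∈Str , m∉) → from neg-def (m∈Str , m∉ ∘ from (∈Int⇔∈ h)))

  ∈Int-⋁ : (⋁ᶜ Γ) ∈ 𝔹 → m ∈Int ⋁ᶜ Γ ⇔ (∃ λ γ → γ ∈ Γ × m ∈Int γ)
  ∈Int-⋁ {Γ} {m} ⋁∈𝔹 =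
    let T , h = Int-total ⋁∈𝔹 ; ⋁-def = Int-⋁ Γ T h m ⇔-∘ ∈Int⇔∈ h in
    mk⇔ (λ m∈ → let γ , S , γ∈Γ , h′ , m∈S = to ⋁-def m∈ in γ , γ∈Γ , S , h′ , m∈S)
        (λ (γ , γ∈Γ , S , h′ , m∈S) → from ⋁-def (γ , S , γ∈Γ , h′ , m∈S))

  ∈Int-⋀ : Γ ⊆ 𝔹 → (⋀ᶜ Γ) ∈ 𝔹 → m ∈Int ⋀ᶜ Γ ⇔ (m ∈ Str × (∀ γ → γ ∈ Γ → m ∈Int γ))
  ∈Int-⋀ {Γ} {m} Γ⊆𝔹 ⋀∈𝔹 =
    let T , h = Int-total ⋀∈𝔹 ; ⋀-def = Int-⋀ Γ T h m ⇔-∘ ∈Int⇔∈ h in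
    mk⇔ (λ m∈ → let m∈Str , h′ = to ⋀-def m∈ in m∈Str , λ γ γ∈Γ →
          let S , k = Int-total (Γ⊆𝔹 γ γ∈Γ) in S , k , h′ γ S γ∈Γ k)
        (λ (m∈Str , h′) → from ⋀-def (m∈Str , λ γ S γ∈Γ k → to (∈Int⇔∈ k) (h′ γ γ∈Γ)))

-- Measure

¬positive⇒<0 : IsReal r → ¬ Positive r → codeℚ q ∈ r → q < 0ℚ
¬positive⇒<0 {q = q} real 0∉r q∈r with <-cmp q 0ℚ
... | tri< q<0 _ _  = q<0
... | tri≈ _ refl _ = contradiction q∈r 0∉r
... | tri> _ _ 0<q  = contradiction (IsReal.downward real 0ℚ q 0<q q∈r) 0∉r

<Sum⇒<0 : ∀ rs → ListAll (λ r → IsReal r × ¬ Positive r) rs → q <Sum rs → q < 0ℚ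
<Sum⇒<0 []       []                  q<0                    = q<0
<Sum⇒<0 (r ∷ rs) ((real , ¬pos) ∷ h) (p , p′ , refl , p∈r , p′<) =
  +-mono-< {p} {0ℚ} {p′} {0ℚ} (¬positive⇒<0 {q = p} real ¬pos p∈r) (<Sum⇒<0 rs h p′<)

-- The cut is open at 0, so it contains some `p > 0`; the split 0 = `p` + (- `p`) leaves a negative
-- rest, as the empty sum demands.
positive⇒0<Sum : IsReal r → Positive r → 0ℚ <Sum (r ∷ [])
positive⇒0<Sum real 0∈r = let p , 0<p , p∈r = IsReal.open′ real 0ℚ 0∈r in
  p , - p , sym (+-inverseʳ p) , p∈r , neg-antimono-< 0<p

0<1 : 0ℚ < 1ℚ
0<1 = toWitness {a? = 0ℚ <? 1ℚ} _

module Measure (em : ExcludedMiddle (lsuc 0ℓ)) {V : Class} (isModel : IsModel V) {κ X L : 𝕍}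
               (V-κ : V κ) (ordinal : IsOrdinal κ) (infinite : Infinite κ)
               (B : BorelCodes κ X L V)
               {μ : 𝕍} (probability : IsProbabilityκMeasure κ X L B μ) where
  open IsModel isModel
  open Model isModel
  open Classical em
  open Ordinal ordinal
  open Families em isModel V-κ ordinal infinite
  open BorelCodes B
  open Codes em isModel B
  open IsProbabilityκMeasure probability renaming (function to μ-function)
  open MeasurableClosed (proj₁ (proj₂ σ-def))
  open FunctionProperties μ-function public
    renaming (dom to μ-dom; total to μ-total; unique to μ-unique)

  V-o : V o
  V-o = transitive o∈κ V-κ

  -- Complements are relative to `Str`, so a set is recovered from its double complement only if it
  -- is included in `Str`; the inclusion is carried along with membership in `σ`.
  Measurable : 𝕍 → Set₁
  Measurable S = S ∈ σ × S ⊆ Str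

  V-measurable : Measurable S → V S
  V-measurable (S∈σ , _) = transitive S∈σ (proj₁ σ-def)

  measurable-resp-≈ : S ≈ T → Measurable S → Measurable T
  measurable-resp-≈ e (S∈σ , S⊆Str) = ∈-respˡ e S∈σ , λ m → S⊆Str m ∘ ∈-respʳ (≈-sym e)

  complementOf : V S → ∃ λ C → V C × (∀ m → m ∈ C ⇔ (m ∈ Str × m ∉ S))
  complementOf {S} VS = separate (¬ᵈ (0F ∈ᵈ 1F)) {S ∷ []} (VS ∷ []) Str∈M

  measurable-∁ : Measurable S → V C → (∀ m → m ∈ C ⇔ (m ∈ Str × m ∉ S)) → Measurable C
  measurable-∁ (S∈σ , _) VC C-def = complement _ S∈σ _ VC C-def , λ m → proj₁ ∘ to (C-def m)

  measurable-⋃ : V f → IsFunctionOn κ f → (∀ {i S} → ⟨ i , S ⟩ ∈ f → Measurable S) →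
                 V U → (∀ m → m ∈ U ⇔ (∃₂ λ i S → ⟨ i , S ⟩ ∈ f × m ∈ S)) → Measurable U
  measurable-⋃ {f} {U} Vf fun meas VU U-def =
    let r , Vr , r-def = range fun V-κ Vf in
    union r Vr (λ S S∈r → proj₁ (meas (proj₂ (to (r-def S) S∈r)))) (range-injects Vf fun Vr r-def) U VU
      (λ m → mk⇔
        (λ m∈U → let i , S , h , m∈S = to (U-def m) m∈U in S , from (r-def S) (i , h) , m∈S)
        (λ (S , S∈r , m∈S) → let i , h = to (r-def S) S∈r in from (U-def m) (i , S , h , m∈S)))
    , λ m m∈U → let i , S , h , m∈S = to (U-def m) m∈U in proj₂ (meas h) m m∈S

  module _ (D : Doubleton S T) where
    open Doubleton D using (values) renaming (graph to g)

    values-elim : {P : 𝕍 → Set₁} → (∀ {x y} → x ≈ y → P x → P y) → P S → P T →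
                  ∀ {i y} → ⟨ i , y ⟩ ∈ g → P y
    values-elim resp PS PT h =
      [ (λ e → resp (≈-sym e) PS) , (λ e → resp (≈-sym e) PT) ] (to values (_ , h))

    doubleton-⋃ : (m ∈ S ⊎ m ∈ T) ⇔ (∃₂ λ i R → ⟨ i , R ⟩ ∈ g × m ∈ R)
    doubleton-⋃ = mk⇔
      [ (λ m∈S → let i , h = from values (inj₁ ≈-refl) in i , S , h , m∈S)
      , (λ m∈T → let i , h = from values (inj₂ ≈-refl) in i , T , h , m∈T) ]
      (λ (i , R , h , m∈R) →
        Sum.map (λ e → ∈-respʳ e m∈R) (λ e → ∈-respʳ e m∈R) (to values (i , h)))

  measurable-∪ : Measurable S → Measurable T → V U → (∀ m → m ∈ U ⇔ (m ∈ S ⊎ m ∈ T)) → Measurable U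
  measurable-∪ MS MT VU U-def =
    let D = doubleton (V-measurable MS) (V-measurable MT) in
    measurable-⋃ (Doubleton.M-graph D) (Doubleton.isFunction D) (values-elim D measurable-resp-≈ MS MT) VU
      (λ m → doubleton-⋃ D ⇔-∘ U-def m)

  measurable-∩ : Measurable S → Measurable T → V R → (∀ m → m ∈ R ⇔ (m ∈ S × m ∈ T)) → Measurable R
  measurable-∩ {S} {T} {R} MS MT VR R-def =
    let C , VC , C-def = complementOf (V-measurable MS)
        E , VE , E-def = complementOf (V-measurable MT)
        D = doubleton VC VE
        U , VU , U-def = ⋃-family (Doubleton.M-graph D) (Doubleton.isFunction D)
        U-def′ = λ m → ⇔-sym (doubleton-⋃ D) ⇔-∘ U-def m
    in measurable-∁ (measurable-∪ (measurable-∁ MS VC C-def) (measurable-∁ MT VE E-def) VU U-def′) VR λ m → mk⇔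
      (λ m∈R → let m∈S , m∈T = to (R-def m) m∈R in proj₂ MS m m∈S , λ m∈U →
        [ (λ m∈C → proj₂ (to (C-def m) m∈C) m∈S) , (λ m∈E → proj₂ (to (E-def m) m∈E) m∈T) ] (to (U-def′ m) m∈U))
      (λ (m∈Str , m∉U) → from (R-def m)
        ( byContradiction₀ (λ m∉S → m∉U (from (U-def′ m) (inj₁ (from (C-def m) (m∈Str , m∉S)))))
        , byContradiction₀ (λ m∉T → m∉U (from (U-def′ m) (inj₂ (from (E-def m) (m∈Str , m∉T)))))))

  -- The empty set plays three parts here: the family, the graph of its injection into `κ`, and the
  -- union.
  measurable-o : Measurable o
  measurable-o =
    union o V-o (λ z z∈o → contradiction z∈o (o-empty z))
      (o , V-o , ((λ p p∈o → contradiction p∈o (o-empty p)) , (λ x x∈o → contradiction x∈o (o-empty x)))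
        , (λ y i h → contradiction h (o-empty _)) , λ y z i h → contradiction h (o-empty _))
      o V-o (λ m → mk⇔ (λ m∈o → contradiction m∈o (o-empty m)) (λ (S , S∈o , _) → contradiction S∈o (o-empty S)))
    , λ m m∈o → contradiction m∈o (o-empty m)

  measurable-Str : Measurable Str
  measurable-Str = measurable-∁ measurable-o Str∈M λ m → mk⇔ (λ m∈Str → m∈Str , o-empty m) proj₁

  V-Int : ⟨ γ , S ⟩ ∈ Int → V S
  V-Int h = proj₂ (M-⟨⟩ (transitive h Int∈M))

  measurable-basic : ∀ {n} (φ : Conjunction L n) {a} → a FromSet X → ⟨ basicᶜ φ a , S ⟩ ∈ Int → Measurable S
  measurable-basic {S} [] {a} aX h =
    measurable-resp-≈ (⊆-antisym (λ m m∈Str → from (Int-basic [] a S aX h m) (m∈Str , []))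
                                 (λ m → proj₁ ∘ to (Int-basic [] a S aX h m))) measurable-Str
  measurable-basic {S} (l ∷ φ) {a} aX h =
    let A , hA = Int-total (basic-closed _ (_ , l ∷ [] , a , aX , ≈-refl))
        E , hE = Int-total (basic-closed _ (_ , φ , a , aX , ≈-refl))
        A-def = Int-basic (l ∷ []) a A aX hA
        E-def = Int-basic φ a E aX hE
        S-def = Int-basic (l ∷ φ) a S aX h
        A-literal = λ m → mk⇔ (λ m∈A → let m∈Str , l⊨ = to (A-def m) m∈A in m∈Str , ListAll.head l⊨)
                              (λ (m∈Str , ⊨l) → from (A-def m) (m∈Str , ⊨l ∷ []))
    in measurable-∩ (literal l a aX A (V-Int hA) A-literal , λ m → proj₁ ∘ to (A-def m))
                    (measurable-basic φ aX hE) (V-Int h) λ m → mk⇔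
      (λ m∈S → let m∈Str , ⊨lφ = to (S-def m) m∈S in
        from (A-literal m) (m∈Str , ListAll.head ⊨lφ) , from (E-def m) (m∈Str , ListAll.tail ⊨lφ))
      (λ (m∈A , m∈E) → let m∈Str , ⊨l = to (A-literal m) m∈A in
        from (S-def m) (m∈Str , ⊨l ∷ proj₂ (to (E-def m) m∈E)))

  MeasurableCode : 𝕍 → Set₁
  MeasurableCode γ = ∀ {S} → ⟨ γ , S ⟩ ∈ Int → Measurable S

  measurable-¬ : γ ∈ 𝔹 → MeasurableCode γ → MeasurableCode (¬ᶜ γ)
  measurable-¬ γ∈𝔹 meas h′ = let S , h = Int-total γ∈𝔹 in
    measurable-∁ (meas h) (V-Int h′) (Int-neg _ _ _ h h′)

  measurable-⋁ : IsFamily κ X L V Γ → Γ ⊆ 𝔹 → (∀ {γ} → γ ∈ Γ → MeasurableCode γ) → MeasurableCode (⋁ᶜ Γ)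
  measurable-⋁ {Γ} (f , Vf , fun , Γ-def) Γ⊆𝔹 meas {T} hT =
    measurable-⋃ (F .M-graph) (F .isFunction)
      (λ h → let γ , hγ , S , hS , R-def = F .value h in
        measurable-∩ (meas (from (Γ-def γ) (_ , hγ)) hS) measurable-Str
          (proj₂ (M-⟨⟩ (transitive h (F .M-graph)))) R-def)
      (V-Int hT) λ m → mk⇔
        (λ m∈T →
          let γ , S , γ∈Γ , hS , m∈S = to (Int-⋁ Γ T hT m) m∈T
              i , hi = to (Γ-def γ) γ∈Γ
              R , VR , R-def = separate (0F ∈ᵈ 1F) {Str ∷ []} (Str∈M ∷ []) (V-Int hS)
          in i , R , F .∈-graph (FunctionProperties.dom fun hi) VR (γ , hi , S , hS , R-def)
             , from (R-def m) (m∈S , proj₂ (meas γ∈Γ hS) m m∈S))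
        (λ (i , R , h , m∈R) → let γ , hγ , S , hS , R-def = F .value h in
          from (Int-⋁ Γ T hT m) (γ , S , from (Γ-def γ) (_ , hγ) , hS , proj₁ (to (R-def m) m∈R)))
    where
    -- Meeting with `Str` alters no interpretation; it only composes the family with `Int`.
    F = meets Vf fun Int∈M Int-fun (λ h → Γ⊆𝔹 _ (from (Γ-def _) (_ , h))) Str∈M

  -- The tag is a component of a negated code, which lies in `𝔹` and hence in the transitive class
  -- `V`; the empty conjunction supplies a code to negate.
  V-1 : V (# 1)
  V-1 = proj₁ (M-⟨⟩ (transitive (¬-closed _ (basic-closed c₀ (0 , [] , [] , [] , ≈-refl {c₀}))) M-𝔹))
    where c₀ = basicᶜ {L} [] []

  -- By de Morgan this reduces meets to joins, both for measurability and in the truth lemma.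
  negate-family : IsFamily κ X L V Γ → Γ ⊆ 𝔹 →
    ∃ λ Γ¬ → V Γ¬ × IsFamily κ X L V Γ¬ × Γ¬ ⊆ 𝔹 × (∀ ζ → ζ ∈ Γ¬ ⇔ (∃ λ γ → γ ∈ Γ × ζ ≈ ¬ᶜ γ))
  negate-family {Γ} (f , Vf , fun , Γ-def) Γ⊆𝔹 =
    let g = negations Vf fun V-1
        r , Vr , r-def = range (g .isFunction) V-κ (g .M-graph)
        r-def′ = λ ζ → mk⇔
          (λ ζ∈r → let i , h = to (r-def ζ) ζ∈r ; γ , hγ , e = g .value h in γ , from (Γ-def γ) (i , hγ) , e)
          (λ (γ , γ∈Γ , e) → let i , hγ = to (Γ-def γ) γ∈Γ in
            from (r-def ζ) (i , g .∈-graph (FunctionProperties.dom fun hγ)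
              (respects (≈-sym e) (M-pair V-1 (transitive (Γ⊆𝔹 γ γ∈Γ) M-𝔹))) (γ , hγ , e)))
    in r , Vr , (g .graph , g .M-graph , g .isFunction , r-def)
       , (λ ζ ζ∈r → let γ , γ∈Γ , e = to (r-def′ ζ) ζ∈r in ∈-respˡ (≈-sym e) (¬-closed γ (Γ⊆𝔹 γ γ∈Γ)))
       , r-def′

  measurable-⋀ : IsFamily κ X L V Γ → Γ ⊆ 𝔹 → (∀ {γ} → γ ∈ Γ → MeasurableCode γ) → MeasurableCode (⋀ᶜ Γ)
  measurable-⋀ {Γ} fam Γ⊆𝔹 meas {T} hT =
    let Γ¬ , VΓ¬ , fam¬ , Γ¬⊆𝔹 , Γ¬-def = negate-family fam Γ⊆𝔹
        U , hU = Int-total (⋁-closed Γ¬ VΓ¬ fam¬ Γ¬⊆𝔹)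
        meas¬ = λ {ζ} (ζ∈ : ζ ∈ Γ¬) {S} (h : ⟨ ζ , S ⟩ ∈ Int) → let γ , γ∈Γ , e = to (Γ¬-def ζ) ζ∈ in
          measurable-¬ (Γ⊆𝔹 γ γ∈Γ) (meas γ∈Γ) (∈-respˡ (⟨⟩-cong e (≈-refl {S})) h)
        T-def = Int-⋀ Γ T hT
        U-def = Int-⋁ Γ¬ U hU
    in measurable-∁ (measurable-⋁ fam¬ Γ¬⊆𝔹 (λ {ζ} → meas¬ {ζ}) hU) (V-Int hT) λ m → mk⇔
      (λ m∈T → let m∈Str , m⊨Γ = to (T-def m) m∈T in m∈Str , λ m∈U →
        let ζ , S , ζ∈ , hS , m∈S = to (U-def m) m∈U
            γ , γ∈Γ , e = to (Γ¬-def ζ) ζ∈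
            R , hR = Int-total (Γ⊆𝔹 γ γ∈Γ)
        in proj₂ (to (Int-neg γ R S hR (∈-respˡ (⟨⟩-cong e (≈-refl {S})) hS) m) m∈S) (m⊨Γ γ R γ∈Γ hR))
      (λ (m∈Str , m∉U) → from (T-def m) (m∈Str , λ γ R γ∈Γ hR → byContradiction₀ λ m∉R →
        let S , hS = Int-total (¬-closed γ (Γ⊆𝔹 γ γ∈Γ)) in
        m∉U (from (U-def m) (¬ᶜ γ , S , from (Γ¬-def _) (γ , γ∈Γ , ≈-refl) , hS
                            , from (Int-neg γ R S hR hS m) (m∈Str , m∉R)))))

  measurable-Int : MeasurableCode γ
  measurable-Int h = 𝔹-induction MeasurableCode
    (λ e meas {S} h → meas (∈-respˡ (⟨⟩-cong (≈-sym e) (≈-refl {S})) h))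
    (λ φ a aX {S} → measurable-basic φ aX)
    measurable-¬ (λ _ → measurable-⋁) (λ _ → measurable-⋀) (Int-dom h) h

  -- The forcing sees a measure only through its sign, so all later measure theory is phrased in
  -- terms of positive sets.
  Pos : 𝕍 → Set₁
  Pos S = ∃ λ r → ⟨ S , r ⟩ ∈ μ × Positive r

  pos-resp-≈ : S ≈ T → Pos S → Pos T
  pos-resp-≈ e (r , h , 0∈r) = r , ∈-respˡ (⟨⟩-cong e ≈-refl) h , 0∈r

  pos⇒positive : Pos S → ⟨ S , r ⟩ ∈ μ → Positive r
  pos⇒positive (s , h , 0∈s) h′ = ∈-respʳ (μ-unique h h′) 0∈s

  pos⇒inhabited : Pos S → ∃ (_∈ S)
  pos⇒inhabited {S} (r , h , 0∈r) = byContradiction λ none →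
    contradiction (to (null S r (λ m m∈S → none (m , m∈S)) h 0ℚ) 0∈r) (<-irrefl refl)

  ¬pos⇒Is0 : ¬ Pos S → ⟨ S , r ⟩ ∈ μ → Is 0ℚ r
  ¬pos⇒Is0 {S} {r} ¬pos h p = mk⇔
    (¬positive⇒<0 (proj₁ (real S r h)) (λ 0∈r → ¬pos (r , h , 0∈r)))
    (proj₂ (real S r h) p)

  Is0⇒¬pos : ⟨ S , r ⟩ ∈ μ → Is 0ℚ r → ¬ Pos S
  Is0⇒¬pos h is0 pos = contradiction (to (is0 0ℚ) (pos⇒positive pos h)) (<-irrefl refl)

  pos-Str : Pos Str
  pos-Str = let r , h = μ-total (proj₁ measurable-Str) in r , h , from (total r h 0ℚ) 0<1

  -- Positivity of κ-indexed unions

  module Disjointification {N U : 𝕍} (V-N : V N) (N-function : IsFunctionOn κ N)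
                           (N-measurable : ∀ {i S} → ⟨ i , S ⟩ ∈ N → Measurable S)
                           (U-measurable : Measurable U)
                           (U-def : ∀ m → m ∈ U ⇔ (∃₂ λ i S → ⟨ i , S ⟩ ∈ N × m ∈ S)) where
    open FunctionProperties N-function renaming (dom to N-dom; total to N-total; unique to N-unique)

    A : FunctionOn κ λ i S → ∃ λ T → ⟨ i , T ⟩ ∈ N × (∀ m → m ∈ S ⇔ (m ∈ T × ¬ Before N i m))
    A = disjointify V-N N-function

    disjoint : ∀ i j S T → ⟨ i , S ⟩ ∈ A .graph → ⟨ j , T ⟩ ∈ A .graph → ¬ (i ≈ j) → Disjoint S T
    disjoint i j S T hS hT i≉j m m∈S m∈T =
      let S′ , hS′ , S-def = A .value hS ; T′ , hT′ , T-def = A .value hT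
          m∈S′ , ¬before-i = to (S-def m) m∈S ; m∈T′ , ¬before-j = to (T-def m) m∈T
      in [ (λ i∈j → ¬before-j (i , i∈j , S′ , hS′ , m∈S′))
         , [ i≉j , (λ j∈i → ¬before-i (j , j∈i , T′ , hT′ , m∈T′)) ] ] (trichotomous (N-dom hS′) (N-dom hT′))

    ⋃A : ∀ m → m ∈ U ⇔ (∃₂ λ i S → ⟨ i , S ⟩ ∈ A .graph × m ∈ S)
    ⋃A m = mk⇔ first-occurrence (λ (i , S , h , m∈S) → let T , h′ , S-def = A .value h in
        from (U-def m) (i , T , h′ , proj₁ (to (S-def m) m∈S)))
      where
      first-occurrence : m ∈ U → ∃₂ λ i S → ⟨ i , S ⟩ ∈ A .graph × m ∈ S
      first-occurrence m∈U =
        let i , (T , h , m∈T) , i-least = byContradiction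
              (¬¬minimal (λ i → ∃ λ S → ⟨ i , S ⟩ ∈ N × m ∈ S) (to (U-def m) m∈U))
            S , h′ = FunctionProperties.total (A .isFunction) (N-dom h)
            T′ , hT′ , S-def = A .value h′
        in i , S , h′ , from (S-def m) (∈-respʳ (N-unique h hT′) m∈T , λ (j , j∈i , before) → i-least j j∈i before)

    -- The i-th piece is Str ∖ ((Str ∖ N i) ∪ ⋃ⱼ N j), where j ranges over i.
    A-measurable : ∀ {i S} → ⟨ i , S ⟩ ∈ A .graph → Measurable S
    A-measurable {i} {S} hS =
      let T , hT , S-def = A .value hS
          C , VC , C-def = complementOf (proj₂ (M-⟨⟩ (transitive hT V-N)))
          C-measurable = measurable-∁ (N-measurable hT) VC C-def
          i∈κ = N-dom hT
          g = ifᶠ V-N (transitive i∈κ V-κ) VC (λ k∈κ _ → N-total k∈κ) N-unique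
          W , VW , W-def = ⋃-family (g .M-graph) (g .isFunction)
          W-measurable = measurable-⋃ (g .M-graph) (g .isFunction)
            (λ h → [ (λ (_ , h′) → N-measurable h′)
                   , (λ (_ , e) → measurable-resp-≈ (≈-sym e) C-measurable) ] (g .value h))
            VW W-def
      in measurable-∁ W-measurable (proj₂ (M-⟨⟩ (transitive hS (A .M-graph)))) λ m → mk⇔
        (λ m∈S → let m∈T , ¬before = to (S-def m) m∈S in proj₂ (N-measurable hT) m m∈T , λ m∈W →
          let k , R , h , m∈R = to (W-def m) m∈W in
          [ (λ (k∈i , h′) → ¬before (k , k∈i , R , h′ , m∈R))
          , (λ (_ , e) → proj₂ (to (C-def m) (∈-respʳ e m∈R)) m∈T) ] (g .value h))
        (λ (m∈Str , m∉W) → from (S-def m)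
          ( byContradiction₀ (λ m∉T → m∉W (from (W-def m)
              -- The index `i` is not a member of itself, so it receives the default value `C`.
              (i , C , g .∈-graph i∈κ VC (inj₂ (∈-irrefl , ≈-refl)) , from (C-def m) (m∈Str , m∉T))))
          , λ (j , j∈i , R , h , m∈R) → m∉W (from (W-def m)
              (j , R , g .∈-graph (N-dom h) (V-measurable (N-measurable h)) (inj₁ (j∈i , h)) , m∈R))))

    μ-sum : ⟨ U , r ⟩ ∈ μ → IsSum (λ i s → ∃ λ S → ⟨ i , S ⟩ ∈ A .graph × ⟨ S , s ⟩ ∈ μ) r
    μ-sum h = κ-additive (A .graph) (A .M-graph) (A .isFunction) (λ i S h → proj₁ (A-measurable h))
                         disjoint U _ ⋃A h

    -- A positive sum exceeds 0 already on finitely many pieces, whereas a finite sum of null terms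
    -- contains only negative rationals.
    pos-⋃⇒pos-piece : Pos U → ∃₂ λ i S → ⟨ i , S ⟩ ∈ A .graph × Pos S
    pos-⋃⇒pos-piece (r , h , 0∈r) = byContradiction λ none →
      let ts , pieces , _ , 0< = to (μ-sum h 0ℚ) 0∈r in
      contradiction (<Sum⇒<0 (List.map proj₂ ts) (map⁺ (ListAll.map
        (λ {t} (S , hS , hs) → proj₁ (real S _ hs) , λ 0∈s → none (_ , S , hS , _ , hs , 0∈s)) pieces)) 0<)
        (<-irrefl refl)

    pos-piece⇒pos-⋃ : ∀ {i S} → ⟨ i , S ⟩ ∈ A .graph → Pos S → Pos U
    pos-piece⇒pos-⋃ {i} {S} hS (s , hs , 0∈s) = let r , h = μ-total (proj₁ U-measurable) in
      r , h , from (μ-sum h 0ℚ)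
        ((i , s) ∷ [] , (S , hS , hs) ∷ [] , [] ∷ [] , positive⇒0<Sum (proj₁ (real S s hs)) 0∈s)

  -- Monotonicity from additivity: `T` is the union of the family with `S` at index `o` and `T`
  -- elsewhere, and its first disjoint piece is `S` unchanged.
  pos-mono : Measurable S → Measurable T → S ⊆ T → Pos S → Pos T
  pos-mono {S} {T} MS MT S⊆T = pos-piece⇒pos-⋃
      (A .∈-graph o∈κ (V-measurable MS)
        (S , D.first , λ m → mk⇔ (λ m∈S → m∈S , λ (j , j∈o , _) → o-empty j j∈o) proj₁))
    where
    D : Doubleton S T
    D = doubleton (V-measurable MS) (V-measurable MT)
    module D = Doubleton D

    open Disjointification D.M-graph D.isFunction (values-elim D measurable-resp-≈ MS MT) MT
      (λ m → doubleton-⋃ D ⇔-∘ mk⇔ inj₂ [ S⊆T m , id ])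

  -- This is κ-completeness of the null ideal: some disjoint piece is positive, and it is included
  -- in the entry it was cut from.
  pos-⋃ : V N → IsFunctionOn κ N → (∀ {i S} → ⟨ i , S ⟩ ∈ N → Measurable S) →
          V U → (∀ m → m ∈ U ⇔ (∃₂ λ i S → ⟨ i , S ⟩ ∈ N × m ∈ S)) →
          Pos U → ∃₂ λ i S → ⟨ i , S ⟩ ∈ N × Pos S
  pos-⋃ VN fun meas VU U-def pos =
    let i , S , h , pos-S = pos-⋃⇒pos-piece pos
        T , hT , S-def = A .value h
    in i , T , hT , pos-mono (A-measurable h) (meas hT) (λ m → proj₁ ∘ to (S-def m)) pos-S
    where open Disjointification VN fun meas (measurable-⋃ VN fun meas VU U-def) U-def

-- The generic filter

module Filter (em : ExcludedMiddle (lsuc 0ℓ)) {V : Class} (isModel : IsModel V) {κ X L : 𝕍}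
              (V-κ : V κ) (ordinal : IsOrdinal κ) (infinite : Infinite κ)
              (B : BorelCodes κ X L V)
              {μ : 𝕍} (V-μ : V μ) (probability : IsProbabilityκMeasure κ X L B μ)
              {G : 𝕍} (isGeneric : IsRandomGenericFilter κ X L B μ G) where
  open IsModel isModel
  open Model isModel
  open Classical em
  open Families em isModel V-κ ordinal infinite
  open BorelCodes B
  open Codes em isModel B
  open Measure em isModel V-κ ordinal infinite B probability
  open IsRandomGenericFilter isGeneric

  private
    O⁺ : 𝕍 → Set₁
    O⁺ = InO⁺ κ X L B μ

    infix 4 _⊑_ _≲_
    _⊑_ _≲_ : 𝕍 → 𝕍 → Set₁
    γ ⊑ ζ = ∀ {m} → m ∈Int γ → m ∈Int ζ
    γ ≲ ζ = _≼_ κ X L B μ γ ζ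

  pos⇒O⁺ : ⟨ γ , S ⟩ ∈ Int → Pos S → O⁺ γ
  pos⇒O⁺ h (r , hr , 0∈r) = Int-dom h , r , (_ , h , hr) , 0∈r

  O⁺⇒pos : O⁺ γ → ⟨ γ , S ⟩ ∈ Int → Pos S
  O⁺⇒pos (_ , r , (T , h′ , hr) , 0∈r) h = pos-resp-≈ (Int-unique h′ h) (r , hr , 0∈r)

  O⁺⇒inhabited : O⁺ γ → ∃ (_∈Int γ)
  O⁺⇒inhabited pos = let S , h = Int-total (proj₁ pos) ; m , m∈S = pos⇒inhabited (O⁺⇒pos pos h) in m , S , h , m∈S

  O⁺-mono : ζ ∈ 𝔹 → γ ⊑ ζ → O⁺ γ → O⁺ ζ
  O⁺-mono ζ∈𝔹 γ⊑ζ pos =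
    let S , hS = Int-total (proj₁ pos) ; T , hT = Int-total ζ∈𝔹 in
    pos⇒O⁺ hT (pos-mono (measurable-Int hS) (measurable-Int hT)
      (λ m m∈S → to (∈Int⇔∈ hT) (γ⊑ζ (S , hS , m∈S))) (O⁺⇒pos pos hS))

  ∈Int⇒∈Str : m ∈Int γ → m ∈ Str
  ∈Int⇒∈Str (S , h , m∈S) = proj₂ (measurable-Int h) _ m∈S

  V-code : γ ∈ 𝔹 → V γ
  V-code γ∈𝔹 = transitive γ∈𝔹 M-𝔹

  ｛｝-family : γ ∈ 𝔹 → ζ ∈ 𝔹 → IsFamily κ X L V ｛ γ , ζ ｝
  ｛｝-family {γ} {ζ} γ∈𝔹 ζ∈𝔹 =
    let D = doubleton (V-code γ∈𝔹) (V-code ζ∈𝔹) in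
    Doubleton.graph D , Doubleton.M-graph D , Doubleton.isFunction D
    , λ x → ⇔-sym (Doubleton.values D) ⇔-∘ ∈-｛｝ {x} {γ} {ζ}

  ｛｝⊆𝔹 : γ ∈ 𝔹 → ζ ∈ 𝔹 → ｛ γ , ζ ｝ ⊆ 𝔹
  ｛｝⊆𝔹 {γ} {ζ} γ∈𝔹 ζ∈𝔹 x x∈ =
    [ (λ e → ∈-respˡ (≈-sym e) γ∈𝔹) , (λ e → ∈-respˡ (≈-sym e) ζ∈𝔹) ] (to (∈-｛｝ {x} {γ} {ζ}) x∈)

  ∧-closed : γ ∈ 𝔹 → ζ ∈ 𝔹 → (γ ∧ᶜ ζ) ∈ 𝔹
  ∧-closed γ∈𝔹 ζ∈𝔹 =
    ⋀-closed _ (M-｛｝ (V-code γ∈𝔹) (V-code ζ∈𝔹)) (｛｝-family γ∈𝔹 ζ∈𝔹) (｛｝⊆𝔹 γ∈𝔹 ζ∈𝔹)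

  ∈Int-∧ : γ ∈ 𝔹 → ζ ∈ 𝔹 → m ∈Int γ ∧ᶜ ζ ⇔ (m ∈Int γ × m ∈Int ζ)
  ∈Int-∧ {γ} {ζ} {m} γ∈𝔹 ζ∈𝔹 = mk⇔
    (λ m∈ → let _ , all = to ⋀-def m∈ in all γ (x∈｛x,y｝ {γ} {ζ}) , all ζ (y∈｛x,y｝ {ζ} {γ}))
    (λ (m∈γ , m∈ζ) → from ⋀-def (∈Int⇒∈Str m∈γ , λ x x∈ →
      [ (λ e → ∈Int-resp-≈ ≈-refl (≈-sym e) m∈γ)
      , (λ e → ∈Int-resp-≈ ≈-refl (≈-sym e) m∈ζ) ] (to (∈-｛｝ {x} {γ} {ζ}) x∈)))
    where
    ⋀-def : m ∈Int γ ∧ᶜ ζ ⇔ (m ∈ Str × (∀ x → x ∈ ｛ γ , ζ ｝ → m ∈Int x))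
    ⋀-def = ∈Int-⋀ (｛｝⊆𝔹 γ∈𝔹 ζ∈𝔹) (∧-closed γ∈𝔹 ζ∈𝔹)

  -- The traces of the `Int γ` on `Int δ` form a κ-indexed family with union `Int δ`, so they cannot
  -- all be null.
  O⁺-⋁ : O⁺ δ → IsFamily κ X L V Γ → Γ ⊆ 𝔹 → (∀ {m} → m ∈Int δ → ∃ λ γ → γ ∈ Γ × m ∈Int γ) →
         ∃ λ γ → γ ∈ Γ × O⁺ (δ ∧ᶜ γ)
  O⁺-⋁ {δ} {Γ} pos (f , Vf , fun , Γ-def) Γ⊆𝔹 cover =
    let S , hS = Int-total (proj₁ pos)
        MS = measurable-Int hS
        F = meets Vf fun Int∈M Int-fun (λ h → Γ⊆𝔹 _ (from (Γ-def _) (_ , h))) (V-Int hS)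
        F-measurable = λ {i} {R} (h : ⟨ i , R ⟩ ∈ F .graph) →
          let γ , hγ , T , hT , R-def = F .value h in
          measurable-∩ (measurable-Int hT) MS (proj₂ (M-⟨⟩ (transitive h (F .M-graph)))) R-def
        i , R , h , pos-R = pos-⋃ (F .M-graph) (F .isFunction)
          (λ {i} {R} → F-measurable {i} {R}) (V-Int hS) (λ m → mk⇔
          (λ m∈S →
            let γ , γ∈Γ , T , hT , m∈T = cover (S , hS , m∈S)
                i , hi = to (Γ-def γ) γ∈Γ
                R , VR , R-def = separate (0F ∈ᵈ 1F) {S ∷ []} (V-Int hS ∷ []) (V-Int hT)
            in i , R , F .∈-graph (FunctionProperties.dom fun hi) VR (γ , hi , T , hT , R-def)
               , from (R-def m) (m∈T , m∈S))
          (λ (i , R , h , m∈R) → let _ , _ , _ , _ , R-def = F .value h in proj₂ (to (R-def m) m∈R)))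
          (O⁺⇒pos pos hS)
        γ , hγ , T , hT , R-def = F .value h
        γ∈Γ = from (Γ-def γ) (i , hγ)
        E , hE = Int-total (∧-closed (proj₁ pos) (Γ⊆𝔹 γ γ∈Γ))
    in γ , γ∈Γ , pos⇒O⁺ hE (pos-mono (F-measurable {i} {R} h) (measurable-Int hE)
      (λ m m∈R → let m∈T , m∈S = to (R-def m) m∈R in
        to (∈Int⇔∈ hE) (from (∈Int-∧ (proj₁ pos) (Γ⊆𝔹 γ γ∈Γ)) ((S , hS , m∈S) , (T , hT , m∈T)))) pos-R)

  O⁺-∨ : O⁺ δ → γ ∈ 𝔹 → ζ ∈ 𝔹 → (∀ {m} → m ∈Int δ → m ∈Int γ ⊎ m ∈Int ζ) → O⁺ (δ ∧ᶜ γ) ⊎ O⁺ (δ ∧ᶜ ζ)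
  O⁺-∨ {δ} {γ} {ζ} pos γ∈𝔹 ζ∈𝔹 cover =
    let x , x∈ , pos-x = O⁺-⋁ pos (｛｝-family γ∈𝔹 ζ∈𝔹) (｛｝⊆𝔹 γ∈𝔹 ζ∈𝔹)
          (λ m∈ → [ (λ m∈γ → γ , x∈｛x,y｝ {γ} {ζ} , m∈γ) , (λ m∈ζ → ζ , y∈｛x,y｝ {ζ} {γ} , m∈ζ) ] (cover m∈))
        x∈𝔹 = ｛｝⊆𝔹 γ∈𝔹 ζ∈𝔹 x x∈
        -- The chosen `x` is only `≈` to `γ` or to `ζ`, so positivity is carried over to that code.
        move = λ {y} (y∈𝔹 : y ∈ 𝔹) (e : x ≈ y) → O⁺-mono (∧-closed (proj₁ pos) y∈𝔹) (λ m∈ →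
          let m∈δ , m∈x = to (∈Int-∧ (proj₁ pos) x∈𝔹) m∈ in
          from (∈Int-∧ (proj₁ pos) y∈𝔹) (m∈δ , ∈Int-resp-≈ ≈-refl e m∈x)) pos-x
    in Sum.map (move γ∈𝔹) (move ζ∈𝔹) (to (∈-｛｝ {x} {γ} {ζ}) x∈)

  excluded-middle : γ ∈ 𝔹 → m ∈ Str → m ∈Int γ ⊎ m ∈Int ¬ᶜ γ
  excluded-middle {γ} {m} γ∈𝔹 m∈Str with em {m ∈Int γ}
  ... | yes m∈γ = inj₁ m∈γ
  ... | no m∉γ  = inj₂ (from (∈Int-¬ γ∈𝔹) (m∈Str , m∉γ))

  O⁺-split : O⁺ δ → γ ∈ 𝔹 → O⁺ (δ ∧ᶜ γ) ⊎ O⁺ (δ ∧ᶜ (¬ᶜ γ))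
  O⁺-split pos γ∈𝔹 = O⁺-∨ pos γ∈𝔹 (¬-closed _ γ∈𝔹) (excluded-middle γ∈𝔹 ∘ ∈Int⇒∈Str)

  ≲⇒null : γ ≲ ζ → ¬ O⁺ (γ ∧ᶜ (¬ᶜ ζ))
  ≲⇒null (r , (S , h , hr) , is0) pos = Is0⇒¬pos hr is0 (O⁺⇒pos pos h)

  null⇒≲ : γ ∈ 𝔹 → ζ ∈ 𝔹 → ¬ O⁺ (γ ∧ᶜ (¬ᶜ ζ)) → γ ≲ ζ
  null⇒≲ γ∈𝔹 ζ∈𝔹 null =
    let S , h = Int-total (∧-closed γ∈𝔹 (¬-closed _ ζ∈𝔹)) ; r , hr = μ-total (proj₁ (measurable-Int h)) in
    r , (S , h , hr) , ¬pos⇒Is0 (null ∘ pos⇒O⁺ h) hr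

  ⊑⇒≲ : γ ∈ 𝔹 → ζ ∈ 𝔹 → γ ⊑ ζ → γ ≲ ζ
  ⊑⇒≲ γ∈𝔹 ζ∈𝔹 γ⊑ζ = null⇒≲ γ∈𝔹 ζ∈𝔹 λ pos →
    let m , m∈ = O⁺⇒inhabited pos ; m∈γ , m∈¬ζ = to (∈Int-∧ γ∈𝔹 (¬-closed _ ζ∈𝔹)) m∈ in
    proj₂ (to (∈Int-¬ ζ∈𝔹) m∈¬ζ) (γ⊑ζ m∈γ)

  ∈G⇒∈𝔹 : γ ∈ G → γ ∈ 𝔹
  ∈G⇒∈𝔹 γ∈G = proj₁ (subset _ γ∈G)

  G-inhabited : γ ∈ G → ∃ (_∈Int γ)
  G-inhabited γ∈G = O⁺⇒inhabited (subset _ γ∈G)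

  G-upward : γ ∈ G → ζ ∈ 𝔹 → γ ⊑ ζ → ζ ∈ G
  G-upward γ∈G ζ∈𝔹 γ⊑ζ =
    upward _ _ γ∈G (O⁺-mono ζ∈𝔹 γ⊑ζ (subset _ γ∈G)) (⊑⇒≲ (∈G⇒∈𝔹 γ∈G) ζ∈𝔹 γ⊑ζ)

  -- The part of `ξ` outside `γ ∧ᶜ ζ` splits into a part missing `γ` and a part missing `ζ`, each
  -- null.
  below-∧ : γ ∈ 𝔹 → ζ ∈ 𝔹 → ξ ≲ γ → ξ ≲ ζ → ξ ∈ 𝔹 → ¬ O⁺ (ξ ∧ᶜ (¬ᶜ (γ ∧ᶜ ζ)))
  below-∧ {γ} {ζ} {ξ} γ∈𝔹 ζ∈𝔹 ξ≲γ ξ≲ζ ξ∈𝔹 pos =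
    [ (λ pos′ → ≲⇒null {ξ} {γ} ξ≲γ (O⁺-mono {ξ ∧ᶜ (¬ᶜ γ)} {β ∧ᶜ (¬ᶜ γ)} (∧-closed ξ∈𝔹 ¬γ∈𝔹) (sub {γ} γ∈𝔹) pos′))
    , (λ pos′ → ≲⇒null {ξ} {ζ} ξ≲ζ (O⁺-mono {ξ ∧ᶜ (¬ᶜ ζ)} {β ∧ᶜ (¬ᶜ ζ)} (∧-closed ξ∈𝔹 ¬ζ∈𝔹) (sub {ζ} ζ∈𝔹) pos′))
    ] (O⁺-∨ {β} {¬ᶜ γ} {¬ᶜ ζ} pos ¬γ∈𝔹 ¬ζ∈𝔹 cover)
    where
    β : 𝕍
    β = ξ ∧ᶜ (¬ᶜ (γ ∧ᶜ ζ))

    ∧∈𝔹 : (γ ∧ᶜ ζ) ∈ 𝔹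
    ∧∈𝔹 = ∧-closed γ∈𝔹 ζ∈𝔹

    ¬γ∈𝔹 : (¬ᶜ γ) ∈ 𝔹
    ¬γ∈𝔹 = ¬-closed γ γ∈𝔹

    ¬ζ∈𝔹 : (¬ᶜ ζ) ∈ 𝔹
    ¬ζ∈𝔹 = ¬-closed ζ ζ∈𝔹

    ∈β : m ∈Int β → m ∈Int ξ × m ∈Int ¬ᶜ (γ ∧ᶜ ζ)
    ∈β = to (∈Int-∧ {ξ} {¬ᶜ (γ ∧ᶜ ζ)} ξ∈𝔹 (¬-closed (γ ∧ᶜ ζ) ∧∈𝔹))

    sub : x ∈ 𝔹 → (β ∧ᶜ (¬ᶜ x)) ⊑ (ξ ∧ᶜ (¬ᶜ x))
    sub {x} x∈𝔹 m∈ =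
      let m∈β , m∈¬x = to (∈Int-∧ {β} {¬ᶜ x} (proj₁ pos) (¬-closed x x∈𝔹)) m∈ in
      from (∈Int-∧ {ξ} {¬ᶜ x} ξ∈𝔹 (¬-closed x x∈𝔹)) (proj₁ (∈β m∈β) , m∈¬x)

    cover : m ∈Int β → m ∈Int ¬ᶜ γ ⊎ m ∈Int ¬ᶜ ζ
    cover {m} m∈β =
      let m∈Str , m∉∧ = to (∈Int-¬ {γ ∧ᶜ ζ} ∧∈𝔹) (proj₂ (∈β m∈β)) in
      [ (λ m∈γ → [ (λ m∈ζ → contradiction (from (∈Int-∧ {γ} {ζ} γ∈𝔹 ζ∈𝔹) (m∈γ , m∈ζ)) m∉∧) , inj₂ ]
                   (excluded-middle {ζ} ζ∈𝔹 m∈Str))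
      , inj₁ ] (excluded-middle {γ} γ∈𝔹 m∈Str)

  -- Directedness only gives some `ξ ∈ G` below both. As `ξ` is positive and its part outside
  -- `γ ∧ᶜ ζ` is null, the conjunction is itself a condition, so upward closure applies.
  G-∧ : γ ∈ G → ζ ∈ G → (γ ∧ᶜ ζ) ∈ G
  G-∧ {γ} {ζ} γ∈G ζ∈G = fromCommonBound (directed γ ζ γ∈G ζ∈G)
    where
    γ∈𝔹 : γ ∈ 𝔹
    γ∈𝔹 = ∈G⇒∈𝔹 γ∈G

    ζ∈𝔹 : ζ ∈ 𝔹
    ζ∈𝔹 = ∈G⇒∈𝔹 ζ∈G

    ∧∈𝔹 : (γ ∧ᶜ ζ) ∈ 𝔹
    ∧∈𝔹 = ∧-closed {γ} {ζ} γ∈𝔹 ζ∈𝔹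

    ∧-pos : ∀ {ξ} → ξ ∈ G → ¬ O⁺ (ξ ∧ᶜ (¬ᶜ (γ ∧ᶜ ζ))) → O⁺ (γ ∧ᶜ ζ)
    ∧-pos {ξ} ξ∈G null =
      [ O⁺-mono {γ ∧ᶜ ζ} {ξ ∧ᶜ (γ ∧ᶜ ζ)} ∧∈𝔹 ξ∧⊑ , (λ pos → contradiction pos null) ]
      (O⁺-split {ξ} {γ ∧ᶜ ζ} (subset ξ ξ∈G) ∧∈𝔹)
      where
      ξ∧⊑ : (ξ ∧ᶜ (γ ∧ᶜ ζ)) ⊑ (γ ∧ᶜ ζ)
      ξ∧⊑ {m} m∈ = proj₂ (to (∈Int-∧ {ξ} {γ ∧ᶜ ζ} {m} (∈G⇒∈𝔹 ξ∈G) ∧∈𝔹) m∈)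

    fromCommonBound : (∃ λ ξ → ξ ∈ G × ξ ≲ γ × ξ ≲ ζ) → (γ ∧ᶜ ζ) ∈ G
    fromCommonBound (ξ , ξ∈G , ξ≲γ , ξ≲ζ) =
      upward ξ (γ ∧ᶜ ζ) ξ∈G (∧-pos {ξ} ξ∈G null) (null⇒≲ {ξ} {γ ∧ᶜ ζ} (∈G⇒∈𝔹 ξ∈G) ∧∈𝔹 null)
      where
      null : ¬ O⁺ (ξ ∧ᶜ (¬ᶜ (γ ∧ᶜ ζ)))
      null = below-∧ {γ} {ζ} {ξ} γ∈𝔹 ζ∈𝔹 ξ≲γ ξ≲ζ (∈G⇒∈𝔹 ξ∈G)

  G-compatible : ∀ γ ζ → γ ∈ G → ζ ∈ G → ∃ λ m → m ∈Int γ × m ∈Int ζ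
  G-compatible γ ζ γ∈G ζ∈G = let m , m∈ = G-inhabited {γ ∧ᶜ ζ} (G-∧ {γ} {ζ} γ∈G ζ∈G) in
    m , to (∈Int-∧ {γ} {ζ} {m} (∈G⇒∈𝔹 γ∈G) (∈G⇒∈𝔹 ζ∈G)) m∈

  G-upward₂ : γ ∈ G → ζ ∈ G → ξ ∈ 𝔹 → (∀ {m} → m ∈Int γ → m ∈Int ζ → m ∈Int ξ) → ξ ∈ G
  G-upward₂ {γ} {ζ} {ξ} γ∈G ζ∈G ξ∈𝔹 imp = G-upward {γ ∧ᶜ ζ} {ξ} (G-∧ {γ} {ζ} γ∈G ζ∈G) ξ∈𝔹
    (λ {m} m∈ → let m∈γ , m∈ζ = to (∈Int-∧ {γ} {ζ} {m} (∈G⇒∈𝔹 γ∈G) (∈G⇒∈𝔹 ζ∈G)) m∈ in imp m∈γ m∈ζ)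

  G-exclusive : ∀ γ ζ → ¬ (∃ λ m → m ∈Int γ × m ∈Int ζ) → γ ∈ G → ζ ∉ G
  G-exclusive γ ζ none γ∈G ζ∈G = none (G-compatible γ ζ γ∈G ζ∈G)

  -- The conditions below some Int γ are dense below δ; adding those disjoint
  -- from Int δ makes them dense.
  G-⋁ : V Γ → IsFamily κ X L V Γ → Γ ⊆ 𝔹 → δ ∈ G →
        (∀ {m} → m ∈Int δ → ∃ λ γ → γ ∈ Γ × m ∈Int γ) → ∃ λ γ → γ ∈ Γ × γ ∈ G
  G-⋁ {Γ} {δ} VΓ fam Γ⊆𝔹 δ∈G cover = let S , hS = Int-total δ∈𝔹 in conclude hS (decided hS)
    where
    δ∈𝔹 : δ ∈ 𝔹
    δ∈𝔹 = ∈G⇒∈𝔹 δ∈G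

    -- Uses plain inclusion and disjointness of interpretations in place of `≼`, so that bounded
    -- quantifiers over sets of V express it, no conjunction codes enter the formula, and separation
    -- in V forms the dense set.
    Decides : 𝕍 → 𝕍 → Set₁
    Decides S η = ∃ λ T → ⟨ η , T ⟩ ∈ Int × Pos T ×
      ((∃ λ γ → γ ∈ Γ × ∃ λ R → ⟨ γ , R ⟩ ∈ Int × (∀ m → m ∈ T → m ∈ R)) ⊎ (∀ m → m ∈ T → m ∉ S))

    -- The rational zero is a parameter of the dense set; it belongs to the cut that is the measure
    -- of `Str`, hence to `V`.
    V-0 : V (codeℚ 0ℚ)
    V-0 = let r , hr , 0∈r = pos-Str in transitive 0∈r (proj₂ (M-⟨⟩ (transitive hr V-μ)))

    decided : ⟨ δ , S ⟩ ∈ Int → ∃ λ D → V D × (∀ η → η ∈ D ⇔ (η ∈ 𝔹 × Decides S η))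
    decided {S} hS = separate
      (∃⟨⟩∈ᵈ 0F 1F (∃⟨⟩∈ᵈ 0F 3F (5F ∈ᵈ 0F) ∧ᵈ
        (∃∈ᵈ 5F (∃⟨⟩∈ᵈ 0F 3F (∀∈ᵈ 2F (0F ∈ᵈ 1F))) ∨ᵈ ∀∈ᵈ 0F (¬ᵈ (0F ∈ᵈ 7F)))))
      {Int ∷ μ ∷ codeℚ 0ℚ ∷ Γ ∷ S ∷ []} (Int∈M ∷ V-μ ∷ V-0 ∷ VΓ ∷ V-Int hS ∷ []) M-𝔹

    below-γ : ∀ {S η γ} → γ ∈ Γ → (pos : O⁺ ((η ∧ᶜ δ) ∧ᶜ γ)) → (η ∧ᶜ δ) ∈ 𝔹 → Decides S ((η ∧ᶜ δ) ∧ᶜ γ)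
    below-γ {S} {η} {γ} γ∈Γ pos ηδ∈𝔹 =
      let T , hT = Int-total (proj₁ pos) ; R , hR = Int-total (Γ⊆𝔹 γ γ∈Γ) in
      T , hT , O⁺⇒pos {(η ∧ᶜ δ) ∧ᶜ γ} pos hT , inj₁ (γ , γ∈Γ , R , hR , λ m m∈T →
        to (∈Int⇔∈ {γ} hR) (proj₂ (to (∈Int-∧ {η ∧ᶜ δ} {γ} ηδ∈𝔹 (Γ⊆𝔹 γ γ∈Γ)) (T , hT , m∈T))))

    below-¬δ : ∀ {S η} → ⟨ δ , S ⟩ ∈ Int → η ∈ 𝔹 → O⁺ (η ∧ᶜ (¬ᶜ δ)) → Decides S (η ∧ᶜ (¬ᶜ δ))
    below-¬δ {S} {η} hS η∈𝔹 pos =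
      let T , hT = Int-total (proj₁ pos) in
      T , hT , O⁺⇒pos {η ∧ᶜ (¬ᶜ δ)} pos hT , inj₂ λ m m∈T m∈S →
        let _ , m∈¬δ = to (∈Int-∧ {η} {¬ᶜ δ} η∈𝔹 (¬-closed δ δ∈𝔹)) (T , hT , m∈T) in
        proj₂ (to (∈Int-¬ {δ} δ∈𝔹) m∈¬δ) (S , hS , m∈S)

    dense : ⟨ δ , S ⟩ ∈ Int → ∀ η → O⁺ η → ∃ λ ξ → ξ ∈ 𝔹 × Decides S ξ × ξ ≲ η
    dense {S} hS η pos = [ meets-δ , misses-δ ] (O⁺-split {η} {δ} pos δ∈𝔹)
      where
      η∈𝔹 : η ∈ 𝔹
      η∈𝔹 = proj₁ pos

      ∈ηδ : m ∈Int (η ∧ᶜ δ) → m ∈Int η × m ∈Int δ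
      ∈ηδ = to (∈Int-∧ {η} {δ} η∈𝔹 δ∈𝔹)

      meets-δ : O⁺ (η ∧ᶜ δ) → ∃ λ ξ → ξ ∈ 𝔹 × Decides S ξ × ξ ≲ η
      meets-δ pos′ =
        let γ , γ∈Γ , pos″ = O⁺-⋁ {η ∧ᶜ δ} pos′ fam Γ⊆𝔹 (λ m∈ → cover (proj₂ (∈ηδ m∈))) in
        (η ∧ᶜ δ) ∧ᶜ γ , proj₁ pos″ , below-γ {S} {η} {γ} γ∈Γ pos″ (proj₁ pos′)
        , ⊑⇒≲ {(η ∧ᶜ δ) ∧ᶜ γ} {η} (proj₁ pos″) η∈𝔹
            (λ m∈ → proj₁ (∈ηδ (proj₁ (to (∈Int-∧ {η ∧ᶜ δ} {γ} (proj₁ pos′) (Γ⊆𝔹 γ γ∈Γ)) m∈))))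

      misses-δ : O⁺ (η ∧ᶜ (¬ᶜ δ)) → ∃ λ ξ → ξ ∈ 𝔹 × Decides S ξ × ξ ≲ η
      misses-δ pos′ = η ∧ᶜ (¬ᶜ δ) , proj₁ pos′ , below-¬δ {S} {η} hS η∈𝔹 pos′
        , ⊑⇒≲ {η ∧ᶜ (¬ᶜ δ)} {η} (proj₁ pos′) η∈𝔹
            (λ m∈ → proj₁ (to (∈Int-∧ {η} {¬ᶜ δ} η∈𝔹 (¬-closed δ δ∈𝔹)) m∈))

    conclude : ∀ {S} → ⟨ δ , S ⟩ ∈ Int → (∃ λ D → V D × (∀ η → η ∈ D ⇔ (η ∈ 𝔹 × Decides S η))) →
               ∃ λ γ → γ ∈ Γ × γ ∈ G
    conclude {S} hS (D , VD , D-def) = fromMember (generic D VD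
      ( (λ η η∈D → let _ , T , hT , pos , _ = to (D-def η) η∈D in pos⇒O⁺ {η} hT pos)
      , (λ η pos → let ξ , ξ∈𝔹 , decides , ξ≲η = dense hS η pos in ξ , from (D-def ξ) (ξ∈𝔹 , decides) , ξ≲η)))
      where
      fromMember : (∃ λ η → η ∈ D × η ∈ G) → ∃ λ γ → γ ∈ Γ × γ ∈ G
      fromMember (η , η∈D , η∈G) =
        let _ , T , hT , _ , below⊎disjoint = to (D-def η) η∈D in
        [ (λ (γ , γ∈Γ , R , hR , T⊆R) → γ , γ∈Γ , G-upward {η} {γ} η∈G (Γ⊆𝔹 γ γ∈Γ) (λ {m} m∈η →
            R , hR , T⊆R m (to (∈Int⇔∈ {η} hT) m∈η)))
        , (λ disjoint →
            let m , m∈η , m∈δ = G-compatible η δ η∈G δ∈G in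
            ⊥-elim (disjoint m (to (∈Int⇔∈ {η} hT) m∈η) (to (∈Int⇔∈ {δ} hS) m∈δ)))
        ] below⊎disjoint

  G-decides : γ ∈ 𝔹 → γ ∈ G ⊎ (¬ᶜ γ) ∈ G
  G-decides {γ} γ∈𝔹 = fromMember (G-⋁ {｛ γ , ¬ᶜ γ ｝} {proj₁ nonempty}
      (M-｛｝ {γ} {¬ᶜ γ} (V-code γ∈𝔹) (V-code ¬γ∈𝔹)) (｛｝-family γ∈𝔹 ¬γ∈𝔹) (｛｝⊆𝔹 γ∈𝔹 ¬γ∈𝔹) (proj₂ nonempty) cover)
    where
    ¬γ∈𝔹 : (¬ᶜ γ) ∈ 𝔹
    ¬γ∈𝔹 = ¬-closed γ γ∈𝔹

    cover : m ∈Int proj₁ nonempty → ∃ λ ζ → ζ ∈ ｛ γ , ¬ᶜ γ ｝ × m ∈Int ζ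
    cover m∈ = [ (λ m∈γ → γ , x∈｛x,y｝ {γ} {¬ᶜ γ} , m∈γ) , (λ m∈¬γ → ¬ᶜ γ , y∈｛x,y｝ {¬ᶜ γ} {γ} , m∈¬γ) ]
                 (excluded-middle {γ} γ∈𝔹 (∈Int⇒∈Str m∈))

    fromMember : (∃ λ x → x ∈ ｛ γ , ¬ᶜ γ ｝ × x ∈ G) → γ ∈ G ⊎ (¬ᶜ γ) ∈ G
    fromMember (x , x∈ , x∈G) =
      Sum.map (λ e → ∈-respˡ {x} {γ} e x∈G) (λ e → ∈-respˡ {x} {¬ᶜ γ} e x∈G) (to (∈-｛｝ {x} {γ} {¬ᶜ γ}) x∈)

  G-consistent : γ ∈ G → (¬ᶜ γ) ∉ G
  G-consistent {γ} γ∈G ¬γ∈G = let m , m∈γ , m∈¬γ = G-compatible γ (¬ᶜ γ) γ∈G ¬γ∈G in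
    proj₂ (to (∈Int-¬ {γ} (∈G⇒∈𝔹 γ∈G)) m∈¬γ) m∈γ

  G-ultra : ∀ γ → γ ∈ 𝔹 → γ ∉ G → (¬ᶜ γ) ∈ G
  G-ultra γ γ∈𝔹 γ∉G = [ (λ γ∈G → contradiction γ∈G γ∉G) , id ] (G-decides γ∈𝔹)

-- The generic structure

module GenericStructure
    (em : ExcludedMiddle (lsuc 0ℓ)) {V : Class} (V-isModel : IsModel V) {κ X L : 𝕍}
    (V-κ : V κ) (ordinal : IsOrdinal κ) (infinite : Infinite κ)
    (B : BorelCodes κ X L V)
    {μ : 𝕍} (V-μ : V μ) (probability : IsProbabilityκMeasure κ X L B μ)
    {G : 𝕍} (isGeneric : IsRandomGenericFilter κ X L B μ G)
    {W : Class} (W-isModel : IsModel W) (V⊆W : ∀ x → V x → W x) (W-G : W G)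
    (B′ : BorelCodes κ X L W) where
  open Classical em
  open BorelCodes B
  open Codes em V-isModel B
  open Measure em V-isModel V-κ ordinal infinite B probability using (negate-family)
  open Filter em V-isModel V-κ ordinal infinite B V-μ probability isGeneric
  open IsRandomGenericFilter isGeneric using (nonempty)

  private
    module W  = Model W-isModel
    module B′ = BorelCodes B′
    module C′ = Codes em W-isModel B′

  abstract
    -- The union of the structures in V bounds the separation, which is carried out in `W` since `G`
    -- is a parameter. It also makes every member an atom of a structure, so the result is again a
    -- structure.
    structure : ∃ λ M → W M × (∀ p → p ∈ M ⇔ ((∃ λ m → m ∈ Str × p ∈ m) ×
                  (∃ λ g → g ∈ G × ∃ λ S → ⟨ g , S ⟩ ∈ Int × (∀ m → m ∈ S → p ∈ m))))
    structure =
      let Z , W-Z , Z-def = W.unions (V⊆W _ Str∈M)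
          M , W-M , M-def = W.separate (W.∃∈ᵈ 1F (W.∃⟨⟩∈ᵈ 0F 3F (W.∀∈ᵈ 0F (3F W.∈ᵈ 0F))))
                              {G ∷ Int ∷ []} (W-G ∷ V⊆W _ Int∈M ∷ []) W-Z
      in M , W-M , λ p → mk⇔
        (λ p∈M → let p∈Z , h = to (M-def p) p∈M in to (Z-def p) p∈Z , h)
        (λ (p∈⋃ , h) → from (M-def p) (from (Z-def p) p∈⋃ , h))

  𝓜 : 𝕍
  𝓜 = proj₁ structure

  W-𝓜 : W 𝓜
  W-𝓜 = proj₁ (proj₂ structure)

  𝓜-def : ∀ p → p ∈ 𝓜 ⇔ ((∃ λ m → m ∈ Str × p ∈ m) ×
              (∃ λ g → g ∈ G × ∃ λ S → ⟨ g , S ⟩ ∈ Int × (∀ m → m ∈ S → p ∈ m)))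
  𝓜-def = proj₂ (proj₂ structure)

  𝓜-isStructure : IsStructure κ X L 𝓜
  𝓜-isStructure p p∈M =
    let (m , m∈Str , p∈m) , _ = to (𝓜-def p) p∈M in proj₂ (to (Str-def m) m∈Str) p p∈m

  𝓜∈Str′ : 𝓜 ∈ B′.Str
  𝓜∈Str′ = from (B′.Str-def 𝓜) (W-𝓜 , 𝓜-isStructure)

  module _ {n} {a : Vec 𝕍 n} (aX : a FromSet X) where

    basic∈𝔹 : ∀ φ → basicᶜ {L} φ a ∈ 𝔹
    basic∈𝔹 φ = basic-closed (basicᶜ φ a) (n , φ , a , aX , ≈-refl)

    basic-upward : ∀ {γ} φ → γ ∈ G → (∀ {m} → m ∈Int γ → SatConjunction {L} m φ a) → basicᶜ φ a ∈ G
    basic-upward {γ} φ γ∈G sat = G-upward {γ} {basicᶜ φ a} γ∈G (basic∈𝔹 φ)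
      (λ m∈γ → from (∈Int-basic {φ = φ} aX) (∈Int⇒∈Str m∈γ , sat m∈γ))

    basic-sat : ∀ {m} φ → m ∈Int basicᶜ φ a → SatConjunction {L} m φ a
    basic-sat φ m∈ = proj₂ (to (∈Int-basic {φ = φ} aX) m∈)

    literal-sat : ∀ {m} l → m ∈Int basicᶜ (l ∷ []) a → SatLiteral {L} m l a
    literal-sat l m∈ = ListAll.head (basic-sat (l ∷ []) m∈)

    𝓜⊨rel : ∀ R k (R∈L : ⟨ R , # k ⟩ ∈ L) is →
              SatLiteral {L} 𝓜 (rel R k R∈L is) a ⇔ basicᶜ {L} (rel R k R∈L is ∷ []) a ∈ G
    𝓜⊨rel R k R∈L is = mk⇔ forced forces
      where
      l : Literal L n
      l = rel R k R∈L is

      atom : 𝕍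
      atom = ⟨ R , tuple (Vec.map (lookup a) is) ⟩

      forced : atom ∈ 𝓜 → basicᶜ (l ∷ []) a ∈ G
      forced p∈M = let _ , g , g∈G , S , hS , S⊨ = to (𝓜-def atom) p∈M in
        basic-upward {g} (l ∷ []) g∈G (λ {m} m∈g → S⊨ m (to (∈Int⇔∈ {g} hS) m∈g) ∷ [])

      forces : basicᶜ (l ∷ []) a ∈ G → atom ∈ 𝓜
      forces g∈G =
        -- The code in `G` is positive, hence has a model in V; this puts the atom into the union
        -- that bounds the separation.
        let m , m∈ = G-inhabited {basicᶜ (l ∷ []) a} g∈G
            S , hS = Int-total {basicᶜ (l ∷ []) a} (basic∈𝔹 (l ∷ []))
        in from (𝓜-def atom)
          ( (m , ∈Int⇒∈Str {m} {basicᶜ (l ∷ []) a} m∈ , literal-sat {m} l m∈)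
          , basicᶜ (l ∷ []) a , g∈G , S , hS , λ m m∈S → literal-sat {m} l (S , hS , m∈S))

    -- `neg l` within a basic code and `¬ᶜ` applied to a basic code are different codes with equal
    -- interpretations: the ultrafilter property gives the latter, and upward closure passes to the
    -- former.
    𝓜⊨neg : ∀ l → SatLiteral {L} 𝓜 l a ⇔ basicᶜ {L} (l ∷ []) a ∈ G →
              (¬ SatLiteral {L} 𝓜 l a) ⇔ basicᶜ {L} (neg l ∷ []) a ∈ G
    𝓜⊨neg l rec = mk⇔ forced (λ ¬l∈G sat → inconsistent (to rec sat) ¬l∈G)
      where
      l∈𝔹 : basicᶜ (l ∷ []) a ∈ 𝔹
      l∈𝔹 = basic∈𝔹 (l ∷ [])

      ¬ᶜ⇒neg : (¬ᶜ basicᶜ (l ∷ []) a) ∈ G → basicᶜ (neg l ∷ []) a ∈ G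
      ¬ᶜ⇒neg ¬l∈G = basic-upward {¬ᶜ basicᶜ (l ∷ []) a} (neg l ∷ []) ¬l∈G λ {m} m∈ →
        let m∈Str , m∉ = to (∈Int-¬ {basicᶜ (l ∷ []) a} {m} l∈𝔹) m∈ in
        (λ sat → m∉ (from (∈Int-basic {m} {φ = l ∷ []} aX) (m∈Str , sat ∷ []))) ∷ []

      forced : ¬ SatLiteral {L} 𝓜 l a → basicᶜ (neg l ∷ []) a ∈ G
      forced ¬sat = ¬ᶜ⇒neg (G-ultra (basicᶜ (l ∷ []) a) l∈𝔹 λ l∈G → ¬sat (from rec l∈G))

      incompatible : ¬ (∃ λ m → m ∈Int basicᶜ (l ∷ []) a × m ∈Int basicᶜ (neg l ∷ []) a)
      incompatible (m , m∈l , m∈¬l) = literal-sat {m} (neg l) m∈¬l (literal-sat {m} l m∈l)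

      inconsistent : basicᶜ (l ∷ []) a ∈ G → basicᶜ (neg l ∷ []) a ∉ G
      inconsistent = G-exclusive (basicᶜ (l ∷ []) a) (basicᶜ (neg l ∷ []) a) incompatible

    -- Equality of parameters does not depend on the structure, so it holds in all structures or in
    -- none.
    𝓜⊨eq : ∀ i j → lookup a i ≈ lookup a j ⇔ basicᶜ {L} (eq i j ∷ []) a ∈ G
    𝓜⊨eq i j = mk⇔
      (λ e → basic-upward {proj₁ nonempty} (eq i j ∷ []) (proj₂ nonempty) (λ _ → e ∷ []))
      (λ g∈G → let m , m∈ = G-inhabited {basicᶜ {L} (eq i j ∷ []) a} g∈G in literal-sat {m} (eq i j) m∈)

    𝓜⊨literal : ∀ l → SatLiteral {L} 𝓜 l a ⇔ basicᶜ {L} (l ∷ []) a ∈ G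
    𝓜⊨literal (rel R k R∈L is) = 𝓜⊨rel R k R∈L is
    𝓜⊨literal (eq i j)         = 𝓜⊨eq i j
    𝓜⊨literal (neg l)          = 𝓜⊨neg l (𝓜⊨literal l)

    𝓜⊨conjunction : ∀ φ → SatConjunction {L} 𝓜 φ a ⇔ basicᶜ φ a ∈ G
    𝓜⊨conjunction [] = mk⇔
      (λ _ → basic-upward {proj₁ nonempty} [] (proj₂ nonempty) (λ _ → []))
      (λ _ → [])
    𝓜⊨conjunction (l ∷ φ) = mk⇔
      (λ { (sat-l ∷ sat-φ) → both (to (𝓜⊨literal l) sat-l) (to (𝓜⊨conjunction φ) sat-φ) })
      (λ lφ∈G →
        from (𝓜⊨literal l) (basic-upward {basicᶜ (l ∷ φ) a} (l ∷ []) lφ∈G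
          (λ m∈ → ListAll.head (basic-sat (l ∷ φ) m∈) ∷ []))
        ∷ from (𝓜⊨conjunction φ) (basic-upward {basicᶜ (l ∷ φ) a} φ lφ∈G
          (λ m∈ → ListAll.tail (basic-sat (l ∷ φ) m∈))))
      where
      both : basicᶜ (l ∷ []) a ∈ G → basicᶜ φ a ∈ G → basicᶜ (l ∷ φ) a ∈ G
      both l∈G φ∈G = G-upward₂ {basicᶜ (l ∷ []) a} {basicᶜ φ a} {basicᶜ (l ∷ φ) a} l∈G φ∈G
        (basic∈𝔹 (l ∷ φ)) λ {m} m∈l m∈φ → from (∈Int-basic {m} {φ = l ∷ φ} aX)
          (∈Int⇒∈Str {m} {basicᶜ (l ∷ []) a} m∈l , literal-sat {m} l m∈l ∷ basic-sat {m} φ m∈φ)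

  -- Truth of codes of V in the extension

  family-lift : IsFamily κ X L V Γ → IsFamily κ X L W Γ
  family-lift (f , Vf , h) = f , V⊆W f Vf , h

  𝔹⊆𝔹′ : γ ∈ 𝔹 → γ ∈ B′.𝔹
  𝔹⊆𝔹′ = 𝔹-induction (_∈ B′.𝔹) ∈-respˡ
    (λ {n} φ a aX → C′.basic-closed (basicᶜ φ a) (n , φ , a , aX , ≈-refl))
    (λ {γ} _ → C′.¬-closed γ)
    (λ {Γ} VΓ fam _ rec → C′.⋁-closed Γ (V⊆W Γ VΓ) (family-lift fam) (λ _ → rec))
    (λ {Γ} VΓ fam _ rec → C′.⋀-closed Γ (V⊆W Γ VΓ) (family-lift fam) (λ _ → rec))

  Truth : 𝕍 → Set₁
  Truth γ = 𝓜 B′.∈Int γ ⇔ γ ∈ G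

  truth-¬ : γ ∈ 𝔹 → Truth γ → Truth (¬ᶜ γ)
  truth-¬ {γ} γ∈𝔹 rec = mk⇔
    (λ 𝓜∈¬γ → G-ultra γ γ∈𝔹 (λ γ∈G → proj₂ (to ¬-def 𝓜∈¬γ) (from rec γ∈G)))
    (λ ¬γ∈G → from ¬-def (𝓜∈Str′ , λ 𝓜∈γ → G-consistent {γ} (to rec 𝓜∈γ) ¬γ∈G))
    where
    ¬-def : 𝓜 B′.∈Int ¬ᶜ γ ⇔ (𝓜 ∈ B′.Str × ¬ 𝓜 B′.∈Int γ)
    ¬-def = C′.∈Int-¬ {γ} (𝔹⊆𝔹′ γ∈𝔹)

  -- A filter containing a join may miss all its disjuncts; genericity, through `G-⋁`, supplies one.
  truth-⋁ : V Γ → IsFamily κ X L V Γ → Γ ⊆ 𝔹 → (∀ {γ} → γ ∈ Γ → Truth γ) → Truth (⋁ᶜ Γ)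
  truth-⋁ {Γ} VΓ fam Γ⊆𝔹 rec = mk⇔
    (λ M∈⋁ → let γ , γ∈Γ , M∈γ = to ⋁-def′ M∈⋁ in
      G-upward {γ} {⋁ᶜ Γ} (to (rec γ∈Γ) M∈γ) ⋁∈𝔹 (λ m∈γ → from (∈Int-⋁ {Γ} ⋁∈𝔹) (γ , γ∈Γ , m∈γ)))
    (λ ⋁∈G → let γ , γ∈Γ , γ∈G = G-⋁ {Γ} {⋁ᶜ Γ} VΓ fam Γ⊆𝔹 ⋁∈G (to (∈Int-⋁ {Γ} ⋁∈𝔹)) in
      from ⋁-def′ (γ , γ∈Γ , from (rec γ∈Γ) γ∈G))
    where
    ⋁∈𝔹 : (⋁ᶜ Γ) ∈ 𝔹
    ⋁∈𝔹 = ⋁-closed Γ VΓ fam Γ⊆𝔹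

    ⋁-def′ : 𝓜 B′.∈Int ⋁ᶜ Γ ⇔ (∃ λ γ → γ ∈ Γ × 𝓜 B′.∈Int γ)
    ⋁-def′ = C′.∈Int-⋁ {Γ} (𝔹⊆𝔹′ ⋁∈𝔹)

  -- If the meet were outside `G`, its negation would be in `G`; that negation is covered by the
  -- negated members, so `G-⋁` would put some `¬ᶜ γ` into `G`, against `Truth γ`.
  truth-⋀ : V Γ → IsFamily κ X L V Γ → Γ ⊆ 𝔹 → (∀ {γ} → γ ∈ Γ → Truth γ) → Truth (⋀ᶜ Γ)
  truth-⋀ {Γ} VΓ fam Γ⊆𝔹 rec = mk⇔
    (λ 𝓜∈⋀ → byContradiction₀ λ ⋀∉G →
      refute (proj₂ (to ⋀-def′ 𝓜∈⋀)) (G-ultra (⋀ᶜ Γ) ⋀∈𝔹 ⋀∉G) (negate-family fam Γ⊆𝔹))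
    (λ ⋀∈G → from ⋀-def′ (𝓜∈Str′ , λ γ γ∈Γ → from (rec γ∈Γ)
      (G-upward {⋀ᶜ Γ} {γ} ⋀∈G (Γ⊆𝔹 γ γ∈Γ) (λ m∈⋀ → proj₂ (to (∈Int-⋀ {Γ} Γ⊆𝔹 ⋀∈𝔹) m∈⋀) γ γ∈Γ))))
    where
    ⋀∈𝔹 : (⋀ᶜ Γ) ∈ 𝔹
    ⋀∈𝔹 = ⋀-closed Γ VΓ fam Γ⊆𝔹

    ⋀-def′ : 𝓜 B′.∈Int ⋀ᶜ Γ ⇔ (𝓜 ∈ B′.Str × (∀ γ → γ ∈ Γ → 𝓜 B′.∈Int γ))
    ⋀-def′ = C′.∈Int-⋀ {Γ} (λ γ γ∈Γ → 𝔹⊆𝔹′ (Γ⊆𝔹 γ γ∈Γ)) (𝔹⊆𝔹′ ⋀∈𝔹)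

    refute : (∀ γ → γ ∈ Γ → 𝓜 B′.∈Int γ) → (¬ᶜ (⋀ᶜ Γ)) ∈ G →
      ¬ (∃ λ Γ¬ → V Γ¬ × IsFamily κ X L V Γ¬ × Γ¬ ⊆ 𝔹 × (∀ ζ → ζ ∈ Γ¬ ⇔ (∃ λ γ → γ ∈ Γ × ζ ≈ ¬ᶜ γ)))
    refute M⊨Γ ¬⋀∈G (Γ¬ , VΓ¬ , fam¬ , Γ¬⊆𝔹 , Γ¬-def) =
      let ζ , ζ∈Γ¬ , ζ∈G = G-⋁ {Γ¬} {¬ᶜ (⋀ᶜ Γ)} VΓ¬ fam¬ Γ¬⊆𝔹 ¬⋀∈G some-negation
          γ , γ∈Γ , e = to (Γ¬-def ζ) ζ∈Γ¬
      in G-consistent {γ} (to (rec γ∈Γ) (M⊨Γ γ γ∈Γ)) (∈-respˡ {ζ} {¬ᶜ γ} e ζ∈G)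
      where
      some-negation : m ∈Int ¬ᶜ (⋀ᶜ Γ) → ∃ λ ζ → ζ ∈ Γ¬ × m ∈Int ζ
      some-negation {m} m∈¬⋀ = byContradiction λ none →
        let m∈Str , m∉⋀ = to (∈Int-¬ {⋀ᶜ Γ} ⋀∈𝔹) m∈¬⋀ in
        m∉⋀ (from (∈Int-⋀ {Γ} Γ⊆𝔹 ⋀∈𝔹) (m∈Str , λ γ γ∈Γ → byContradiction λ m∉γ →
          none (¬ᶜ γ , from (Γ¬-def (¬ᶜ γ)) (γ , γ∈Γ , ≈-refl)
               , from (∈Int-¬ {γ} (Γ⊆𝔹 γ γ∈Γ)) (m∈Str , m∉γ))))

  truth : γ ∈ 𝔹 → Truth γ
  truth = 𝔹-induction Truth
    (λ {γ} {ζ} e rec → mk⇔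
      (λ M∈ζ → ∈-respˡ e (to rec (C′.∈Int-resp-≈ ≈-refl (≈-sym e) M∈ζ)))
      (λ ζ∈G → C′.∈Int-resp-≈ ≈-refl e (from rec (∈-respˡ (≈-sym e) ζ∈G))))
    (λ φ a aX → 𝓜⊨conjunction aX φ ⇔-∘ mk⇔ (λ M∈ → proj₂ (to (C′.∈Int-basic {φ = φ} aX) M∈))
                                              (λ sat → from (C′.∈Int-basic {φ = φ} aX) (𝓜∈Str′ , sat)))
    truth-¬ truth-⋁ truth-⋀

  𝓜-unique : W y → (∀ g → IsBasicCode κ X L g × g ∈ G → y B′.∈Int g) → 𝓜 ≈ y
  𝓜-unique {y} W-y y∈ = ⊆-antisym
    (λ p p∈M → transfer p (𝓜-isStructure p p∈M) (λ l aX sat → y⊨ l aX sat) p∈M)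
    (λ p p∈y → transfer p (y-isStructure p p∈y)
      -- Literals are closed under negation, so agreement from `𝓜` to `y` applied to `neg l` gives
      -- the converse for `l`.
      (λ l aX sat → byContradiction₀ λ ¬sat → y⊨ (neg l) aX ¬sat sat) p∈y)
    where
    y∈basic : ∀ {n} (φ : Conjunction L n) {a} (aX : a FromSet X) → SatConjunction 𝓜 φ a → y B′.∈Int basicᶜ φ a
    y∈basic {n} φ {a} aX sat =
      y∈ (basicᶜ φ a) ((n , φ , a , aX , ≈-refl) , to (𝓜⊨conjunction aX φ) sat)

    y-isStructure : IsStructure κ X L y
    -- The empty conjunction without parameters has a basic code in `G`, and its interpretation is
    -- all of `Str` in `W`.
    y-isStructure = proj₂ (to (B′.Str-def y) (proj₁ (to (C′.∈Int-basic {φ = []} []) (y∈basic {0} [] [] []))))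

    y⊨ : ∀ {n} (l : Literal L n) {a} → a FromSet X → SatLiteral 𝓜 l a → SatLiteral y l a
    y⊨ l aX sat = ListAll.head (proj₂ (to (C′.∈Int-basic {φ = l ∷ []} aX) (y∈basic (l ∷ []) aX (sat ∷ []))))

    transfer : ∀ {z z′} p → (∃₂ λ R k → ∃ λ (a : Vec 𝕍 k) → ⟨ R , # k ⟩ ∈ L × a FromSet X × p ≈ ⟨ R , tuple a ⟩) →
      (∀ {n} (l : Literal L n) {a} → a FromSet X → SatLiteral z l a → SatLiteral z′ l a) → p ∈ z → p ∈ z′
    transfer {z} {z′} p (R , k , a , R∈L , aX , e) imp p∈z =
      -- The atom is expressed by the relation symbol applied to the distinct variables `allFin k`,
      -- evaluated at `a`.
      ∈-respˡ (≈-sym e) (subst (λ v → ⟨ R , tuple v ⟩ ∈ z′) (map-lookup-allFin a)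
        (imp (rel R k R∈L (Vec.allFin k)) aX
          (subst (λ v → ⟨ R , tuple v ⟩ ∈ z) (sym (map-lookup-allFin a)) (∈-respˡ e p∈z))))

theorem6p2 :
    ExcludedMiddle (lsuc 0ℓ) →
    (V : Class) → IsModel V →
    (κ X L : 𝕍) →
    V κ → IsOrdinal κ → Infinite κ →
    V X → Infinite X →
    V L → IsRelationalLanguage L →
    (B : BorelCodes κ X L V) →
    (μ : 𝕍) → V μ → IsProbabilityκMeasure κ X L B μ →
    (G : 𝕍) → IsRandomGenericFilter κ X L B μ G →
    (V[G] : Class) → IsGenericExtension V G V[G] →
    (B[G] : BorelCodes κ X L V[G]) →
    let ⋂Int = BorelCodes.InAllInt B[G]
        _∈Int_ = BorelCodes._∈Int_ B[G]
        inG = λ g → Level.Lift (lsuc 0ℓ) (g ∈ G)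
        inG_b = λ g → IsBasicCode κ X L g × g ∈ G
    in
    (∃! _≈_ (⋂Int inG)) ×
    (∀ m → ⋂Int inG m ⇔ ⋂Int inG_b m) ×
    (∀ M_G → V[G] M_G → (∀ m → V[G] m → ⋂Int inG_b m ⇔ m ≈ M_G) →
      ∀ ζ → ζ ∈ G ⇔ (InO⁺ κ X L B μ ζ × (M_G ∈Int ζ)))
theorem6p2 em V V-isModel κ X L V-κ ordinal infinite _ _ _ _ B μ V-μ probability G isGeneric W extension B′ =
    (𝓜 , 𝓜∈all , λ (W-y , y∈) → 𝓜-unique W-y (λ g (_ , g∈G) → y∈ g (lift g∈G)))
  , (λ m → mk⇔
      (λ (W-m , m∈) → W-m , λ g (_ , g∈G) → m∈ g (lift g∈G))
      -- A structure satisfying the basic codes equals `𝓜` by uniqueness, and `𝓜` satisfies every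
      -- code in `G`.
      (λ (W-m , m∈) → W-m , λ g g∈G →
        C′.∈Int-resp-≈ (𝓜-unique W-m m∈) ≈-refl (proj₂ 𝓜∈all g g∈G)))
  , λ M W-M M-def ζ →
      let M∈all-basic = proj₂ (from (M-def M W-M) ≈-refl)
          𝓜≈M = 𝓜-unique W-M M∈all-basic
      in mk⇔
        (λ ζ∈G → IsRandomGenericFilter.subset isGeneric ζ ζ∈G
               , C′.∈Int-resp-≈ 𝓜≈M ≈-refl (proj₂ 𝓜∈all ζ (lift ζ∈G)))
        (λ (ζ∈O⁺ , M∈ζ) → to (truth (proj₁ ζ∈O⁺)) (C′.∈Int-resp-≈ (≈-sym 𝓜≈M) ≈-refl M∈ζ))
  where
  open IsGenericExtension extension
  open Filter em V-isModel V-κ ordinal infinite B V-μ probability isGeneric using (∈G⇒∈𝔹)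
  open GenericStructure em V-isModel V-κ ordinal infinite B V-μ probability isGeneric
                        model includes contains B′
  module C′ = Codes em model B′

  𝓜∈all : BorelCodes.InAllInt B′ (λ g → Level.Lift (lsuc 0ℓ) (g ∈ G)) 𝓜
  𝓜∈all = W-𝓜 , λ g (lift g∈G) → from (truth (∈G⇒∈𝔹 g∈G)) g∈G
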